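{- Let $\mathcal L$ be any one of the logical systems $\mathrm{FO}[\infty]$, $\mathrm{FO[cut]}$, $\mathrm{FO[cut]}\cap\mathrm{WMSO}$ over countable words. Then there is no finite basis for a block product based characterization of $\mathcal L$; that is, there is no finite set $B$ of finite $\circledast$-monoids such that, for every finite alphabet $\Sigma$ and every language $L\subseteq\Sigma^{\circledast}$, $L$ is $\mathcal L$-definable if and only if $L$ is recognized by a finite iterated block product of copies of members of $B$.
   Context: Words. A (countable) word over a set $A$ is a map $w$ from a countable, possibly empty, linear ordering $\mathrm{dom}(w)$ to $A$, taken up to isomorphism; $A^{\circledast}$ is the set of all such words (including the empty word $\varepsilon$). For words $(w_i)_{i\in\alpha}$ indexed by a countable linear ordering $\alpha$, $\prod_{i\in\alpha}w_i$ is their generalized concatenation. Algebra. A $\circledast$-monoid $(M,\mathrm{id},\pi)$ is a set $M$ with a map $\pi:M^{\circledast}\to M$ such that $\pi(a)=a$ for $a\in M$, $\pi(\prod_{i\in\alpha}u_i)=\pi(\prod_{i\in\alpha}\pi(u_i))$ for all countable linear orderings $\alpha$ and words $u_i$ over $M$, and $\mathrm{id}=\pi(\varepsilon)$; write $a\cdot b=\pi(ab)$. A morphism $h:M\to M'$ satisfies $h(\pi(w))=\pi'(\bar h(w))$, where $\bar h$ is the letterwise extension of $h$. $\Sigma^{\circledast}$ with generalized concatenation is the free $\circledast$-monoid over $\Sigma$. $L\subseteq\Sigma^{\circledast}$ is recognized by $M$ if there is a morphism $h:\Sigma^{\circledast}\to M$ with $L=h^{ -1}(h(L))$. Block product. For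 $\circledast$-monoids $M$, $N$, let $K=N^{M\times M}$ (direct power of $N$, with pointwise product $\pi_K$), with left and right actions of $M$ given by $(m*f)(m_1,m_2)=f(m_1\cdot m,m_2)$ and $(f*m)(m_1,m_2)=f(m_1,m\cdot m_2)$. The block product $M\,\Box\,N$ is the semidirect product of $M$ and $K$ for these actions: its underlying set is $M\times K$, and a word $u$ with domain $\alpha$ and $u(x)=(m_x,f_x)$ has product $\big(\pi_M(\prod_{x\in\alpha}m_x),\ \pi_K(\prod_{x\in\alpha}\,p_x*f_x*q_x)\big)$, where $p_x=\pi_M(\prod_{y<x}m_y)$ and $q_x=\pi_M(\prod_{y>x}m_y)$. The finite iterated block products of members of $B$ are the elements of the smallest class containing $B$ and closed under $\Box$. Infinitary rank. Let $\mathcal I_0$ be the set of nonempty finite linear orderings. For $n\ge1$, $\mathcal I_n$ is the set of (nonempty) orderings of the form $\sum_{i\in\mathbb Z}\alpha_i$ with each $\alpha_i\in\mathcal I_{n-1}$ or empty, closed under finite sums. $\mathcal I\text{ - }\mathit{rank}(\alpha)$ is the least $n$ with $\alpha\in\mathcal I_n$, and is infinite if no such $n$ exists. Logics. First-order logic FO has formulas built from $x<y$, $a(x)$ ($a\in\Sigma$; "position $x$ carries letter $a$"), boolean connectives, and $\exists x$, with variables ranging over positions. $\mathrm{FO}[\infty]$ extends FO by the quantifiers $\exists^{\infty_n}x$, $n\in\mathbb N$: $w,s\models\exists^{\infty_n}x\,\varphi$ iff there is $X\subseteq\mathrm{dom}(w)$ with $\mathcal I\text{ - }\mathit{rank}(X)=n$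 (for the induced ordering) and $w,s[x=i]\models\varphi$ for all $i\in X$. $\mathrm{FO[cut]}$ extends FO by quantification over Dedekind cuts, i.e. left-closed subsets $Y$ of $\mathrm{dom}(w)$ (with membership predicate $x\in Y$). $\mathrm{WMSO}$ extends FO by quantification over finite subsets of $\mathrm{dom}(w)$ (with membership predicate). A language is definable in a logic if it is the set of words satisfying some sentence of it; a language is $(\mathrm{FO[cut]}\cap\mathrm{WMSO})$-definable if it is definable in $\mathrm{FO[cut]}$ and also definable in $\mathrm{WMSO}$. -}

module Defs where

open import Data.Empty using (⊥-elim)
open import Data.Fin.Base as Fin using (Fin; zero; suc; toℕ)
import Data.Fin.Properties as Fin
open import Data.Integer.Base as ℤ using (ℤ; +_; -[1+_])
import Data.Integer.Properties as ℤ
open import Data.Irrelevant using ([_])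
open import Data.List.Base using (List; []; _∷_; length; lookup)
open import Data.List.Membership.Propositional using (_∈_)
open import Data.Nat.Base as ℕ using (ℕ; zero; suc)
import Data.Nat.Properties as ℕ
open import Data.Product.Base using (Σ; ∃; ∃-syntax; _×_; _,_; proj₁; proj₂)
open import Data.Product.Relation.Binary.Pointwise.NonDependent using (_×ₛ_)
open import Data.Refinement using (Refinement; value; _,_)
open import Data.Refinement.Properties using (value-injective)
open import Data.Sum.Base using (_⊎_; inj₁; inj₂)
open import Data.Vec.Base as Vec using (Vec; []; _∷_)
open import Function.Base using (_∘_; id)
open import Function.Bundles
  using (Func; Inverse; Injection; _↣_; _⇔_; mk↣)
open import Function.Definitions using (StrictlySurjective)
open import Function.Relation.Binary.Setoid.Equality using (_⇨_)
open import Level using (Level; 0ℓ; Lift; _⊔_) renaming (suc to lsuc)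
open import Relation.Binary.Bundles using (Setoid)
open import Relation.Binary.Core using (Rel)
open import Relation.Binary.Definitions
  using (Transitive; Trichotomous; tri<; tri≈; tri>)
open import Relation.Binary.Morphism.Structures using (IsOrderIsomorphism)
open import Relation.Binary.PropositionalEquality.Core as ≡
  using (_≡_; refl; cong)
import Relation.Binary.PropositionalEquality.Properties as ≡
open import Relation.Binary.Structures using (IsStrictTotalOrder)
import Relation.Binary.Morphism.Construct.Composition as Comp
import Relation.Binary.Reasoning.Setoid as SetoidReasoning
open import Relation.Nullary.Decidable.Core using (recompute)
open import Relation.Nullary.Negation.Core using (¬_)
open import Relation.Unary using (Pred)

private
  variable
    c ℓ c′ ℓ′ : Level

Finite : Setoid c ℓ → Set (c ⊔ ℓ)
Finite S = ∃[ n ] Inverse S (≡.setoid (Fin n))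

record CountableOrder : Set₁ where
  infix 4 _<_
  field
    Carrier            : Set
    _<_                : Rel Carrier 0ℓ
    isStrictTotalOrder : IsStrictTotalOrder _≡_ _<_
    countable          : Carrier ↣ ℕ

  open IsStrictTotalOrder isStrictTotalOrder public
    using (compare; _<?_; irrefl; asym) renaming (trans to <-trans)

∣_∣ : CountableOrder → Set
∣_∣ = CountableOrder.Carrier

infix 4 _[_<_]
_[_<_] : (α : CountableOrder) → Rel ∣ α ∣ 0ℓ
α [ x < y ] = CountableOrder._<_ α x y

infix 4 _≃_
record _≃_ (α β : CountableOrder) : Set where
  field
    to                 : ∣ α ∣ → ∣ β ∣
    isOrderIsomorphism : IsOrderIsomorphism _≡_ _≡_ (α [_<_]) (β [_<_]) to

  open IsOrderIsomorphism isOrderIsomorphism public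
    using (mono; injective; cancel)

  strictlySurjective : StrictlySurjective _≡_ to
  strictlySurjective y =
    let x , eq = IsOrderIsomorphism.surjective isOrderIsomorphism y in x , eq refl

module _ {α β : CountableOrder} where
  private
    module α = CountableOrder α
    module β = CountableOrder β

  mk≃ : (f : ∣ α ∣ → ∣ β ∣) →
        (∀ {x y} → x α.< y → f x β.< f y) →
        StrictlySurjective _≡_ f →
        α ≃ β
  mk≃ f mono surj = record
    { to                 = f
    ; isOrderIsomorphism = record
      { isOrderMonomorphism = record
        { isOrderHomomorphism = record { cong = cong f ; mono = mono }
        ; injective           = inj
        ; cancel              = can
        }
      ; surjective = λ y → proj₁ (surj y) , λ { refl → proj₂ (surj y) }
      }
    }
    where
    inj : ∀ {x y} → f x ≡ f y → x ≡ y
    inj {x} {y} eq with α.compare x y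
    ... | tri< x<y _ _ = ⊥-elim (β.irrefl eq (mono x<y))
    ... | tri≈ _ x≡y _ = x≡y
    ... | tri> _ _ y<x = ⊥-elim (β.irrefl (≡.sym eq) (mono y<x))

    can : ∀ {x y} → f x β.< f y → x α.< y
    can {x} {y} lt with α.compare x y
    ... | tri< x<y _ _  = x<y
    ... | tri≈ _ refl _ = ⊥-elim (β.irrefl refl lt)
    ... | tri> _ _ y<x  = ⊥-elim (β.asym lt (mono y<x))

≃-refl : ∀ {α} → α ≃ α
≃-refl = mk≃ id id (λ x → x , refl)

≃-trans : ∀ {α β γ} → α ≃ β → β ≃ γ → α ≃ γ
≃-trans f g = record
  { to                 = g.to ∘ f.to
  ; isOrderIsomorphism =
      Comp.isOrderIsomorphism ≡.trans f.isOrderIsomorphism g.isOrderIsomorphism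
  }
  where
  module f = _≃_ f
  module g = _≃_ g

≃-sym : ∀ {α β} → α ≃ β → β ≃ α
≃-sym {α} {β} f = mk≃ from mono (λ x → f.to x , f.injective (to-from (f.to x)))
  where
  module f = _≃_ f

  from : ∣ β ∣ → ∣ α ∣
  from = proj₁ ∘ f.strictlySurjective

  to-from : ∀ y → f.to (from y) ≡ y
  to-from = proj₂ ∘ f.strictlySurjective

  mono : ∀ {x y} → β [ x < y ] → α [ from x < from y ]
  mono {x} {y} x<y =
    f.cancel (≡.subst₂ (β [_<_]) (≡.sym (to-from x)) (≡.sym (to-from y)) x<y)

-- The irrelevance of the membership proofs makes this a suborder for every
-- predicate, propositional or not.
infixl 6 _↾_
_↾_ : (α : CountableOrder) → Pred ∣ α ∣ 0ℓ → CountableOrder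
α ↾ X = record
  { Carrier            = Refinement α.Carrier X
  ; _<_                = λ x y → value x α.< value y
  ; isStrictTotalOrder = record
    { isStrictPartialOrder = record
      { isEquivalence = ≡.isEquivalence
      ; irrefl        = λ { refl → α.irrefl refl }
      ; trans         = α.<-trans
      ; <-resp-≈      = (λ { refl lt → lt }) , (λ { refl lt → lt })
      }
    ; compare = cmp
    }
  ; countable = mk↣ {to = enc ∘ value} (λ eq → value-injective (enc-injective eq))
  }
  where
  module α = CountableOrder α
  open Injection α.countable renaming (to to enc; injective to enc-injective)

  cmp : Trichotomous {A = Refinement α.Carrier X} _≡_ (λ x y → value x α.< value y)
  cmp x y with α.compare (value x) (value y)
  ... | tri< a b c = tri< a (λ { refl → b refl }) c
  ... | tri≈ a b c = tri≈ a (value-injective b) c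
  ... | tri> a b c = tri> a (λ { refl → b refl }) c

-- 2ᵐ(2n+1), an injection ℕ × ℕ → ℕ.
pair : ℕ → ℕ → ℕ
pair zero    n = suc (2 ℕ.* n)
pair (suc m) n = 2 ℕ.* pair m n

pair-injective : ∀ m m′ {n n′} → pair m n ≡ pair m′ n′ → m ≡ m′ × n ≡ n′
pair-injective zero    zero    eq = refl , ℕ.*-cancelˡ-≡ _ _ 2 (ℕ.suc-injective eq)
pair-injective zero    (suc m′) {n} {n′} eq =
  ⊥-elim (ℕ.even≢odd (pair m′ n′) n (≡.sym eq))
pair-injective (suc m) zero    {n} {n′} eq =
  ⊥-elim (ℕ.even≢odd (pair m n) n′ eq)
pair-injective (suc m) (suc m′) eq
  with pair-injective m m′ (ℕ.*-cancelˡ-≡ _ _ 2 eq)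
... | refl , refl = refl , refl

data Lex {I : Set} (_<ᵢ_ : Rel I 0ℓ) {X : I → Set}
         (_<ₓ_ : ∀ {i} → Rel (X i) 0ℓ) : Rel (Σ I X) 0ℓ where
  fst : ∀ {i j x y} → i <ᵢ j → Lex _<ᵢ_ _<ₓ_ (i , x) (j , y)
  snd : ∀ {i} {x y : X i} → x <ₓ y → Lex _<ᵢ_ _<ₓ_ (i , x) (i , y)

∑ : (α : CountableOrder) → (∣ α ∣ → CountableOrder) → CountableOrder
∑ α β = record
  { Carrier            = S
  ; _<_                = _≺_
  ; isStrictTotalOrder = record
    { isStrictPartialOrder = record
      { isEquivalence = ≡.isEquivalence
      ; irrefl        = λ { refl → irr }
      ; trans         = tr
      ; <-resp-≈      = (λ { refl lt → lt }) , (λ { refl lt → lt })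
      }
    ; compare = cmp
    }
  ; countable = mk↣ {to = encode} encode-injective
  }
  where
  module α = CountableOrder α
  module β i = CountableOrder (β i)
  open Injection using () renaming (to to _⟨_⟩)

  S : Set
  S = Σ α.Carrier β.Carrier

  _≺_ : Rel S 0ℓ
  _≺_ = Lex α._<_ (λ {i} → β._<_ i)

  irr : ∀ {p} → ¬ (p ≺ p)
  irr (fst lt) = α.irrefl refl lt
  irr (snd lt) = β.irrefl _ refl lt

  tr : Transitive _≺_
  tr (fst p) (fst q) = fst (α.<-trans p q)
  tr (fst p) (snd q) = fst p
  tr (snd p) (fst q) = fst q
  tr (snd p) (snd q) = snd (β.<-trans _ p q)

  asy : ∀ {p q} → p ≺ q → ¬ (q ≺ p)
  asy p q = irr (tr p q)

  cmp : Trichotomous _≡_ _≺_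
  cmp (i , x) (j , y) with α.compare i j
  ... | tri< lt _ _ = tri< (fst lt) (λ { refl → α.irrefl refl lt }) (asy (fst lt))
  ... | tri> _ _ gt = tri> (asy (fst gt)) (λ { refl → α.irrefl refl gt }) (fst gt)
  ... | tri≈ _ refl _ with β.compare i x y
  ...   | tri< lt _ _   = tri< (snd lt) (λ { refl → β.irrefl i refl lt }) (asy (snd lt))
  ...   | tri≈ _ refl _ = tri≈ irr refl irr
  ...   | tri> _ _ gt   = tri> (asy (snd gt)) (λ { refl → β.irrefl i refl gt }) (snd gt)

  encode : S → ℕ
  encode (i , x) = pair (α.countable ⟨ i ⟩) (β.countable i ⟨ x ⟩)

  encode-injective : ∀ {p q} → encode p ≡ encode q → p ≡ q
  encode-injective {i , x} {j , y} eq
    with pair-injective (α.countable ⟨ i ⟩) (α.countable ⟨ j ⟩) eq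
  ... | eqᵢ , eqₓ with Injection.injective α.countable eqᵢ
  ...   | refl = cong (i ,_) (Injection.injective (β.countable i) eqₓ)

ordinal : ℕ → CountableOrder
ordinal n = record
  { Carrier            = Fin n
  ; _<_                = Fin._<_
  ; isStrictTotalOrder = Fin.<-isStrictTotalOrder
  ; countable          = mk↣ {to = toℕ} Fin.toℕ-injective
  }

ℤ-order : CountableOrder
ℤ-order = record
  { Carrier            = ℤ
  ; _<_                = ℤ._<_
  ; isStrictTotalOrder = ℤ.<-isStrictTotalOrder
  ; countable          = mk↣ {to = encode} encode-injective
  }
  where
  encode : ℤ → ℕ
  encode (+ n)    = 2 ℕ.* n
  encode -[1+ n ] = suc (2 ℕ.* n)

  encode-injective : ∀ {i j} → encode i ≡ encode j → i ≡ j
  encode-injective {+ m}      {+ n}      eq = cong +_ (ℕ.*-cancelˡ-≡ m n 2 eq)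
  encode-injective {+ m}      { -[1+ n ]} eq = ⊥-elim (ℕ.even≢odd m n eq)
  encode-injective { -[1+ m ]} {+ n}      eq = ⊥-elim (ℕ.even≢odd n m (≡.sym eq))
  encode-injective { -[1+ m ]} { -[1+ n ]} eq =
    cong -[1+_] (ℕ.*-cancelˡ-≡ m n 2 (ℕ.suc-injective eq))

module _ {α β : CountableOrder} (f : α ≃ β)
         {γ : ∣ α ∣ → CountableOrder} {δ : ∣ β ∣ → CountableOrder}
         (g : ∀ i → γ i ≃ δ (_≃_.to f i)) where
  private
    module f = _≃_ f
    module g i = _≃_ (g i)

  ∑-cong : ∑ α γ ≃ ∑ β δ
  ∑-cong = mk≃ to mono surj
    where
    to : ∣ ∑ α γ ∣ → ∣ ∑ β δ ∣
    to (i , x) = f.to i , g.to i x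

    mono : ∀ {p q} → ∑ α γ [ p < q ] → ∑ β δ [ to p < to q ]
    mono (fst lt) = fst (f.mono lt)
    mono (snd lt) = snd (g.mono _ lt)

    surj : StrictlySurjective _≡_ to
    surj (j , y) with f.strictlySurjective j
    ... | i , refl with g.strictlySurjective i y
    ...   | x , refl = (i , x) , refl

-- A sum of nonempty orderings indexed by Fin k is nonempty exactly when k is
-- positive, so the first argument of +-sum only excludes the empty sum.
data 𝓘 : ℕ → CountableOrder → Set₁ where
  finite : ∀ {α} → ∣ α ∣ → Finite (≡.setoid ∣ α ∣) → 𝓘 0 α
  ℤ-sum  : ∀ {n α} → ∣ α ∣ → (β : ℤ → CountableOrder) →
           (∀ i → 𝓘 n (β i) ⊎ ¬ ∣ β i ∣) → α ≃ ∑ ℤ-order β → 𝓘 (suc n) α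
  +-sum  : ∀ {n α} → ∣ α ∣ → (k : ℕ) (β : Fin k → CountableOrder) →
           (∀ i → 𝓘 (suc n) (β i)) → α ≃ ∑ (ordinal k) β → 𝓘 (suc n) α

𝓘-rank_≡_ : CountableOrder → ℕ → Set₁
𝓘-rank α ≡ n = 𝓘 n α × (∀ {m} → m ℕ.< n → ¬ 𝓘 m α)

record Word (A : Setoid c ℓ) : Set (lsuc 0ℓ ⊔ c) where
  constructor word
  field
    dom    : CountableOrder
    letter : ∣ dom ∣ → Setoid.Carrier A

open Word public

infix 4 _≅_
record _≅_ {A : Setoid c ℓ} (u v : Word A) : Set ℓ where
  constructor _,_
  field
    dom-≃    : dom u ≃ dom v
    letter-≈ : ∀ x → Setoid._≈_ A (letter u x) (letter v (_≃_.to dom-≃ x))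

module _ {A : Setoid c ℓ} where
  private module A = Setoid A

  ≅-refl : {u : Word A} → u ≅ u
  ≅-refl = ≃-refl , λ _ → A.refl

  ≅-trans : {u v w : Word A} → u ≅ v → v ≅ w → u ≅ w
  ≅-trans (f , p) (g , q) = ≃-trans f g , λ x → A.trans (p x) (q _)

  ≅-sym : {u v : Word A} → u ≅ v → v ≅ u
  ≅-sym {u} {v} (f , p) = ≃-sym f , λ y →
    let x , eq = _≃_.strictlySurjective f y in
    A.sym (A.trans (p x) (A.reflexive (cong (letter v) eq)))

  ≅-letters : ∀ {α} {a b : ∣ α ∣ → A.Carrier} →
              (∀ x → a x A.≈ b x) → _≅_ {A = A} (word α a) (word α b)
  ≅-letters p = ≃-refl , p

  ⟪_⟫ : List A.Carrier → Word A
  ⟪ as ⟫ = word (ordinal (length as)) (lookup as)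

  _↾ʷ_ : (w : Word A) → Pred ∣ dom w ∣ 0ℓ → Word A
  w ↾ʷ X = word (dom w ↾ X) (letter w ∘ value)

  before after : (w : Word A) → ∣ dom w ∣ → Word A
  before w x = w ↾ʷ λ y → dom w [ y < x ]
  after  w x = w ↾ʷ λ y → dom w [ x < y ]

  ∏ : (α : CountableOrder) → (∣ α ∣ → Word A) → Word A
  ∏ α u = word (∑ α (dom ∘ u)) λ (i , x) → letter (u i) x

  ∏-cong : ∀ {α β} (f : α ≃ β) {u : ∣ α ∣ → Word A} {v : ∣ β ∣ → Word A} →
           (∀ i → u i ≅ v (_≃_.to f i)) → ∏ α u ≅ ∏ β v
  ∏-cong f g = ∑-cong f (λ i → _≅_.dom-≃ (g i)) , λ (i , x) → _≅_.letter-≈ (g i) x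

wordSetoid : Setoid c ℓ → Setoid (lsuc 0ℓ ⊔ c) ℓ
wordSetoid A = record
  { Carrier       = Word A
  ; _≈_           = _≅_
  ; isEquivalence = record { refl = ≅-refl ; sym = ≅-sym ; trans = ≅-trans }
  }

mapʷ : {A : Setoid c ℓ} {B : Setoid c′ ℓ′} →
       (Setoid.Carrier A → Setoid.Carrier B) → Word A → Word B
mapʷ h w = word (dom w) (h ∘ letter w)

-- Words are taken up to isomorphism, hence π-cong.  In π-∏, the product of the
-- letters π (u i) over α is the word over α with these letters.
record ⊛Monoid (c ℓ : Level) : Set (lsuc (c ⊔ ℓ) ⊔ lsuc 0ℓ) where
  field
    setoid : Setoid c ℓ

  open Setoid setoid public renaming (refl to ≈-refl; sym to ≈-sym; trans to ≈-trans)

  field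
    π      : Word setoid → Carrier
    π-cong : ∀ {u v} → u ≅ v → π u ≈ π v
    π-unit : ∀ a → π ⟪ a ∷ [] ⟫ ≈ a
    π-∏    : ∀ α (u : ∣ α ∣ → Word setoid) → π (∏ α u) ≈ π (word α (π ∘ u))

  id-elem : Carrier
  id-elem = π ⟪ [] ⟫

  infixl 7 _·_
  _·_ : Carrier → Carrier → Carrier
  a · b = π ⟪ a ∷ b ∷ [] ⟫

record Morphism (M : ⊛Monoid c ℓ) (N : ⊛Monoid c′ ℓ′) : Set (lsuc 0ℓ ⊔ c ⊔ ℓ ⊔ c′ ⊔ ℓ′) where
  private
    module M = ⊛Monoid M
    module N = ⊛Monoid N
  field
    func : Func M.setoid N.setoid
  open Func func public
  field
    homo : ∀ w → to (M.π w) N.≈ N.π (mapʷ to w)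

free : Setoid c ℓ → ⊛Monoid (lsuc 0ℓ ⊔ c) ℓ
free A = record
  { setoid = wordSetoid A
  ; π      = λ w → ∏ (dom w) (letter w)
  ; π-cong = λ { (f , p) → ∏-cong f p }
  ; π-unit = unit
  ; π-∏    = assoc
  }
  where
  module A = Setoid A

  unit : ∀ w → ∏ (ordinal 1) (lookup (w ∷ [])) ≅ w
  unit w = ≅-sym (mk≃ (zero ,_) snd (λ { (zero , x) → x , refl }) , λ _ → A.refl)

  assoc : ∀ α (u : ∣ α ∣ → Word (wordSetoid A)) →
          ∏ (∑ α (dom ∘ u)) (λ (i , x) → letter (u i) x) ≅
          ∏ α (λ i → ∏ (dom (u i)) (letter (u i)))
  assoc α u =
    mk≃ (λ ((i , x) , y) → i , (x , y))
        (λ { (fst (fst lt)) → fst lt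
           ; (fst (snd lt)) → snd (fst lt)
           ; (snd lt)       → snd (snd lt) })
        (λ (i , (x , y)) → ((i , x) , y) , refl)
    , λ _ → A.refl

module ⊛MonoidProperties (M : ⊛Monoid c ℓ) where
  open ⊛Monoid M
  open SetoidReasoning setoid

  ·-cong : ∀ {a a′ b b′} → a ≈ a′ → b ≈ b′ → a · b ≈ a′ · b′
  ·-cong p q = π-cong (≅-letters λ { zero → p ; (suc zero) → q })

  π-++ : ∀ u v → π (∏ (ordinal 2) (lookup (u ∷ v ∷ []))) ≈ π u · π v
  π-++ u v = ≈-trans (π-∏ _ _)
    (π-cong (≅-letters λ { zero → ≈-refl ; (suc zero) → ≈-refl }))

  ·-assoc : ∀ a b c → (a · b) · c ≈ a · (b · c)
  ·-assoc a b c = begin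
    (a · b) · c                                                     ≈⟨ ·-cong ≈-refl (π-unit c) ⟨
    π ⟪ a ∷ b ∷ [] ⟫ · π ⟪ c ∷ [] ⟫                                 ≈⟨ π-++ _ _ ⟨
    π (∏ (ordinal 2) (lookup (⟪ a ∷ b ∷ [] ⟫ ∷ ⟪ c ∷ [] ⟫ ∷ [])))   ≈⟨ π-cong reassoc ⟩
    π (∏ (ordinal 2) (lookup (⟪ a ∷ [] ⟫ ∷ ⟪ b ∷ c ∷ [] ⟫ ∷ [])))   ≈⟨ π-++ _ _ ⟩
    π ⟪ a ∷ [] ⟫ · π ⟪ b ∷ c ∷ [] ⟫                                 ≈⟨ ·-cong (π-unit a) ≈-refl ⟩
    a · (b · c)                                                     ∎
    where
    u v : Word setoid
    u = ∏ (ordinal 2) (lookup (⟪ a ∷ b ∷ [] ⟫ ∷ ⟪ c ∷ [] ⟫ ∷ []))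
    v = ∏ (ordinal 2) (lookup (⟪ a ∷ [] ⟫ ∷ ⟪ b ∷ c ∷ [] ⟫ ∷ []))

    to : ∣ dom u ∣ → ∣ dom v ∣
    to (zero , zero)     = zero , zero
    to (zero , suc zero) = suc zero , zero
    to (suc zero , zero) = suc zero , suc zero

    0<1 : ordinal 2 [ zero < suc zero ]
    0<1 = ℕ.z<s

    mono : ∀ {p q} → dom u [ p < q ] → dom v [ to p < to q ]
    mono {zero , zero}     {zero , zero}     (snd ())
    mono {zero , zero}     {zero , suc zero} _ = fst 0<1
    mono {zero , zero}     {suc zero , zero} _ = fst 0<1
    mono {zero , suc zero} {zero , zero}     (snd ())
    mono {zero , suc zero} {zero , suc zero} (snd (ℕ.s≤s ()))
    mono {zero , suc zero} {suc zero , zero} _ = snd 0<1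
    mono {suc zero , zero} {zero , _}        (fst ())
    mono {suc zero , zero} {suc zero , zero} (fst (ℕ.s≤s ()))
    mono {suc zero , zero} {suc zero , zero} (snd ())

    surj : StrictlySurjective _≡_ to
    surj (zero , zero)         = (zero , zero) , refl
    surj (suc zero , zero)     = (zero , suc zero) , refl
    surj (suc zero , suc zero) = (suc zero , zero) , refl

    reassoc : u ≅ v
    reassoc = mk≃ to mono surj , λ
      { (zero , zero)     → ≈-refl
      ; (zero , suc zero) → ≈-refl
      ; (suc zero , zero) → ≈-refl
      }

  module _ (α : CountableOrder) (u : ∣ α ∣ → Word setoid) (i : ∣ α ∣) (x : ∣ dom (u i) ∣) where
    private
      module α = CountableOrder α
      module D = CountableOrder (dom (u i))

    π-before : π (before (∏ α u) (i , x)) ≈ π (before (word α (π ∘ u)) i) · π (before (u i) x)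
    π-before = begin
      π (before (∏ α u) (i , x))             ≈⟨ π-cong split ⟨
      π (∏ (ordinal 2) (lookup (l ∷ r ∷ []))) ≈⟨ π-++ l r ⟩
      π l · π r                              ≈⟨ ·-cong (π-∏ _ _) ≈-refl ⟩
      π (before (word α (π ∘ u)) i) · π r    ∎
      where
      l r : Word setoid
      l = ∏ (α ↾ λ j → j α.< i) (u ∘ value)
      r = before (u i) x

      w : Word setoid
      w = ∏ (ordinal 2) (lookup (l ∷ r ∷ []))

      to : ∣ dom w ∣ → ∣ dom (before (∏ α u) (i , x)) ∣
      to (zero , ((j , [ p ]) , y)) = (j , y) , [ fst p ]
      to (suc zero , (y , [ p ]))   = (i , y) , [ snd p ]

      mono : ∀ {p q} → dom w [ p < q ] → ∑ α (dom ∘ u) [ value (to p) < value (to q) ]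
      mono {zero , _} {zero , _} (snd (fst lt)) = fst lt
      mono {zero , _} {zero , _} (snd (snd lt)) = snd lt
      mono {zero , ((j , [ p ]) , _)} {suc zero , _} _ = fst (recompute (j α.<? i) p)
      mono {suc zero , _} {zero , _} (fst ())
      mono {suc zero , _} {suc zero , _} (fst (ℕ.s≤s ()))
      mono {suc zero , _} {suc zero , _} (snd lt) = snd lt

      surj : StrictlySurjective _≡_ to
      surj ((j , y) , [ p ]) with recompute (CountableOrder._<?_ (∑ α (dom ∘ u)) (j , y) (i , x)) p
      ... | fst lt = (zero , ((j , [ lt ]) , y)) , refl
      ... | snd lt = (suc zero , (y , [ lt ])) , refl

      split : w ≅ before (∏ α u) (i , x)
      split = mk≃ to mono surj , λ { (zero , _) → ≈-refl ; (suc zero , _) → ≈-refl }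

    π-after : π (after (∏ α u) (i , x)) ≈ π (after (u i) x) · π (after (word α (π ∘ u)) i)
    π-after = begin
      π (after (∏ α u) (i , x))              ≈⟨ π-cong split ⟨
      π (∏ (ordinal 2) (lookup (l ∷ r ∷ []))) ≈⟨ π-++ l r ⟩
      π l · π r                              ≈⟨ ·-cong ≈-refl (π-∏ _ _) ⟩
      π l · π (after (word α (π ∘ u)) i)     ∎
      where
      l r : Word setoid
      l = after (u i) x
      r = ∏ (α ↾ λ j → i α.< j) (u ∘ value)

      w : Word setoid
      w = ∏ (ordinal 2) (lookup (l ∷ r ∷ []))

      to : ∣ dom w ∣ → ∣ dom (after (∏ α u) (i , x)) ∣
      to (zero , (y , [ p ]))           = (i , y) , [ snd p ]
      to (suc zero , ((j , [ p ]) , y)) = (j , y) , [ fst p ]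

      mono : ∀ {p q} → dom w [ p < q ] → ∑ α (dom ∘ u) [ value (to p) < value (to q) ]
      mono {zero , _} {zero , _} (snd lt) = snd lt
      mono {zero , _} {suc zero , ((j , [ p ]) , _)} _ = fst (recompute (i α.<? j) p)
      mono {suc zero , _} {zero , _} (fst ())
      mono {suc zero , _} {suc zero , _} (fst (ℕ.s≤s ()))
      mono {suc zero , _} {suc zero , _} (snd (fst lt)) = fst lt
      mono {suc zero , _} {suc zero , _} (snd (snd lt)) = snd lt

      surj : StrictlySurjective _≡_ to
      surj ((j , y) , [ p ]) with recompute (CountableOrder._<?_ (∑ α (dom ∘ u)) (i , x) (j , y)) p
      ... | fst lt = (suc zero , ((j , [ lt ]) , y)) , refl
      ... | snd lt = (zero , (y , [ lt ])) , refl

      split : w ≅ after (∏ α u) (i , x)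
      split = mk≃ to mono surj , λ { (zero , _) → ≈-refl ; (suc zero , _) → ≈-refl }

module BlockProduct (M N : ⊛Monoid 0ℓ 0ℓ) where
  private
    module M  = ⊛Monoid M
    module N  = ⊛Monoid N
    module MP = ⊛MonoidProperties M

  power : ⊛Monoid 0ℓ 0ℓ
  power = record
    { setoid = (M.setoid ×ₛ M.setoid) ⇨ N.setoid
    ; π      = λ w → record
      { to   = λ m → N.π (mapʷ (λ f → Func.to f m) w)
      ; cong = λ eq → N.π-cong (≅-letters λ x → Func.cong (letter w x) eq)
      }
    ; π-cong = λ { (f , p) m → N.π-cong (f , λ x → p x m) }
    ; π-unit = λ f m → N.≈-trans (N.π-cong (≅-letters λ { zero → N.≈-refl }))
                                 (N.π-unit (Func.to f m))
    ; π-∏    = λ α u m → N.π-∏ α (λ i → mapʷ (λ f → Func.to f m) (u i))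
    }

  module K = ⊛Monoid power

  infixl 8 _∗ˡ_
  infixl 8 _∗ʳ_

  _∗ˡ_ : M.Carrier → K.Carrier → K.Carrier
  m ∗ˡ f = record
    { to   = λ (m₁ , m₂) → Func.to f (m₁ M.· m , m₂)
    ; cong = λ (p , q) → Func.cong f (MP.·-cong p M.≈-refl , q)
    }

  _∗ʳ_ : K.Carrier → M.Carrier → K.Carrier
  f ∗ʳ m = record
    { to   = λ (m₁ , m₂) → Func.to f (m₁ , m M.· m₂)
    ; cong = λ (p , q) → Func.cong f (p , MP.·-cong M.≈-refl q)
    }

  carrier : Setoid 0ℓ 0ℓ
  carrier = M.setoid ×ₛ K.setoid

  private module C = Setoid carrier

  prefix suffix : (w : Word carrier) → ∣ dom w ∣ → M.Carrier
  prefix w x = M.π (before (mapʷ proj₁ w) x)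
  suffix w x = M.π (after  (mapʷ proj₁ w) x)

  conjugated : Word carrier → Word K.setoid
  conjugated w = word (dom w) λ x → prefix w x ∗ˡ proj₂ (letter w x) ∗ʳ suffix w x

  product : Word carrier → C.Carrier
  product w = M.π (mapʷ proj₁ w) , K.π (conjugated w)

  private
    restrict-cong : {u v : Word carrier} (e : u ≅ v) →
                    {X : Pred ∣ dom u ∣ 0ℓ} {Y : Pred ∣ dom v ∣ 0ℓ} →
                    (∀ {x} → X x → Y (_≃_.to (_≅_.dom-≃ e) x)) →
                    (∀ {x} → Y (_≃_.to (_≅_.dom-≃ e) x) → X x) →
                    _≅_ {A = M.setoid} (mapʷ proj₁ u ↾ʷ X) (mapʷ proj₁ v ↾ʷ Y)
    restrict-cong {u} {v} (f , p) {X} {Y} X⇒Y Y⇒X =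
      mk≃ (λ { (x , [ q ]) → f.to x , [ X⇒Y q ] }) f.mono surj
      , λ x → proj₁ (p (value x))
      where
      module f = _≃_ f
      surj : StrictlySurjective _≡_ (λ { (x , [ q ]) → f.to x , [ X⇒Y q ] })
      surj (y , [ q ]) with f.strictlySurjective y
      ... | x , refl = (x , [ Y⇒X q ]) , refl

    product-cong : ∀ {u v} → u ≅ v → product u C.≈ product v
    product-cong {u} {v} e@(f , p) =
      M.π-cong (f , proj₁ ∘ p) , λ (m₁ , m₂) → N.π-cong (f , λ x →
        N.≈-trans
          (Func.cong (proj₂ (letter u x))
            ( MP.·-cong M.≈-refl (M.π-cong (restrict-cong e f.mono f.cancel))
            , MP.·-cong (M.π-cong (restrict-cong e f.mono f.cancel)) M.≈-refl))
          (proj₂ (p x) _))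
      where module f = _≃_ f

    empty-before : (u : Word M.setoid) → ¬ ∣ dom u ∣ → ∀ m → m M.· M.π u M.≈ m
    empty-before u ∅ m = begin
      m M.· M.π u                                              ≈⟨ MP.·-cong (M.π-unit m) M.≈-refl ⟨
      M.π ⟪ m ∷ [] ⟫ M.· M.π u                                 ≈⟨ MP.π-++ _ _ ⟨
      M.π (∏ (ordinal 2) (lookup (⟪ m ∷ [] ⟫ ∷ u ∷ [])))       ≈⟨ M.π-cong iso ⟨
      M.π ⟪ m ∷ [] ⟫                                           ≈⟨ M.π-unit m ⟩
      m                                                        ∎
      where
      open SetoidReasoning M.setoid
      iso : ⟪ m ∷ [] ⟫ ≅ ∏ (ordinal 2) (lookup (⟪ m ∷ [] ⟫ ∷ u ∷ []))
      iso = mk≃ (zero ,_) snd (λ { (zero , x) → x , refl ; (suc zero , x) → ⊥-elim (∅ x) })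
          , λ { zero → M.≈-refl }

    empty-after : (u : Word M.setoid) → ¬ ∣ dom u ∣ → ∀ m → M.π u M.· m M.≈ m
    empty-after u ∅ m = begin
      M.π u M.· m                                              ≈⟨ MP.·-cong M.≈-refl (M.π-unit m) ⟨
      M.π u M.· M.π ⟪ m ∷ [] ⟫                                 ≈⟨ MP.π-++ _ _ ⟨
      M.π (∏ (ordinal 2) (lookup (u ∷ ⟪ m ∷ [] ⟫ ∷ [])))       ≈⟨ M.π-cong iso ⟨
      M.π ⟪ m ∷ [] ⟫                                           ≈⟨ M.π-unit m ⟩
      m                                                        ∎
      where
      open SetoidReasoning M.setoid
      iso : ⟪ m ∷ [] ⟫ ≅ ∏ (ordinal 2) (lookup (u ∷ ⟪ m ∷ [] ⟫ ∷ []))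
      iso = mk≃ (suc zero ,_) snd (λ { (suc zero , x) → x , refl ; (zero , x) → ⊥-elim (∅ x) })
          , λ { zero → M.≈-refl }

    product-unit : ∀ a → product ⟪ a ∷ [] ⟫ C.≈ a
    product-unit (m , f) =
      M.≈-trans (M.π-cong (≅-letters λ { zero → M.≈-refl })) (M.π-unit m)
      , λ (m₁ , m₂) → N.≈-trans
          (N.π-cong {v = ⟪ Func.to f (m₁ , m₂) ∷ [] ⟫} (≅-letters λ
            { zero → Func.cong f
                ( empty-before _ (λ { (zero , [ () ]) }) m₁
                , empty-after  _ (λ { (zero , [ () ]) }) m₂) }))
          (N.π-unit _)

    product-∏ : ∀ α (u : ∣ α ∣ → Word carrier) →
                product (∏ α u) C.≈ product (word α (product ∘ u))
    product-∏ α u = M.π-∏ α u₁ , λ (m₁ , m₂) →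
      N.≈-trans
        (N.π-cong (≅-letters λ (i , x) → Func.cong (proj₂ (letter (u i) x))
          ( M.≈-trans (MP.·-cong M.≈-refl (MP.π-before α u₁ i x))
                      (M.≈-sym (MP.·-assoc _ _ _))
          , M.≈-trans (MP.·-cong (MP.π-after α u₁ i x) M.≈-refl)
                      (MP.·-assoc _ _ _))))
        (N.π-∏ α λ i → mapʷ
          (λ f → Func.to f ( m₁ M.· prefix (word α (product ∘ u)) i
                           , suffix (word α (product ∘ u)) i M.· m₂))
          (conjugated (u i)))
      where
      u₁ : ∣ α ∣ → Word M.setoid
      u₁ i = mapʷ proj₁ (u i)

  blockProduct : ⊛Monoid 0ℓ 0ℓ
  blockProduct = record
    { setoid = carrier
    ; π      = product
    ; π-cong = product-cong
    ; π-unit = product-unit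
    ; π-∏    = product-∏
    }

infixr 6 _□_
_□_ : ⊛Monoid 0ℓ 0ℓ → ⊛Monoid 0ℓ 0ℓ → ⊛Monoid 0ℓ 0ℓ
M □ N = BlockProduct.blockProduct M N

data Iterated□ (B : List (⊛Monoid 0ℓ 0ℓ)) : ⊛Monoid 0ℓ 0ℓ → Set₁ where
  member : ∀ {M} → M ∈ B → Iterated□ B M
  block  : ∀ {M N} → Iterated□ B M → Iterated□ B N → Iterated□ B (M □ N)

-- Since a language is an arbitrary predicate, a basis as in the theorem would
-- decide every P : Set₁: the language of all words w such that P is recognized,
-- and a defining sentence can be evaluated on the empty word.  This is why no
-- classical axiom is assumed.
record Language (A : Setoid 0ℓ 0ℓ) : Set (lsuc (lsuc 0ℓ)) where
  field
    holds    : Pred (Word A) (lsuc 0ℓ)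
    respects : ∀ {u v} → u ≅ v → holds u → holds v

open Language public

-- L = h⁻¹(h(L)); the inclusion of L in h⁻¹(h(L)) is automatic.
Recognizes : {A : Setoid 0ℓ 0ℓ} → ⊛Monoid 0ℓ 0ℓ → Language A → Set₁
Recognizes {A} M L = Σ (Morphism (free A) M) λ h → let open Morphism h in
  ∀ w → holds L w ⇔ (∃[ v ] holds L v × to v ≈ to w)
  where open ⊛Monoid M using (_≈_)

-- Formulas with free position variables in Fin n, as de Bruijn indices.
data FO∞ (A : Set) (n : ℕ) : Set where
  _<ᶠ_    : Fin n → Fin n → FO∞ A n
  letterᶠ : A → Fin n → FO∞ A n
  ¬ᶠ_     : FO∞ A n → FO∞ A n
  _∧ᶠ_    : FO∞ A n → FO∞ A n → FO∞ A n
  _∨ᶠ_    : FO∞ A n → FO∞ A n → FO∞ A n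
  ∃ᶠ_     : FO∞ A (suc n) → FO∞ A n
  ∃∞ᶠ     : ℕ → FO∞ A (suc n) → FO∞ A n

-- Formulas with, in addition, free set variables in Fin k.
data FOSet (A : Set) (n k : ℕ) : Set where
  _<ᶠ_    : Fin n → Fin n → FOSet A n k
  letterᶠ : A → Fin n → FOSet A n k
  _∈ᶠ_    : Fin n → Fin k → FOSet A n k
  ¬ᶠ_     : FOSet A n k → FOSet A n k
  _∧ᶠ_    : FOSet A n k → FOSet A n k → FOSet A n k
  _∨ᶠ_    : FOSet A n k → FOSet A n k → FOSet A n k
  ∃ᶠ_     : FOSet A (suc n) k → FOSet A n k
  ∃ˢ_     : FOSet A n (suc k) → FOSet A n k

Subset : CountableOrder → Set₁
Subset α = Pred ∣ α ∣ 0ℓ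

LeftClosed FiniteSubset : (α : CountableOrder) → Pred (Subset α) 0ℓ
LeftClosed   α X = ∀ {x y} → α [ x < y ] → X y → X x
FiniteSubset α X = Finite (≡.setoid ∣ α ↾ X ∣)

module _ {A : Setoid 0ℓ 0ℓ} (w : Word A) where
  private
    module A = Setoid A
    Pos = ∣ dom w ∣

  ⟦_⟧∞ : ∀ {n} → FO∞ A.Carrier n → Vec Pos n → Set₁
  ⟦ x <ᶠ y ⟧∞ s      = Lift _ (dom w [ Vec.lookup s x < Vec.lookup s y ])
  ⟦ letterᶠ a x ⟧∞ s = Lift _ (letter w (Vec.lookup s x) A.≈ a)
  ⟦ ¬ᶠ φ ⟧∞ s        = ¬ ⟦ φ ⟧∞ s
  ⟦ φ ∧ᶠ ψ ⟧∞ s      = ⟦ φ ⟧∞ s × ⟦ ψ ⟧∞ s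
  ⟦ φ ∨ᶠ ψ ⟧∞ s      = ⟦ φ ⟧∞ s ⊎ ⟦ ψ ⟧∞ s
  ⟦ ∃ᶠ φ ⟧∞ s        = ∃[ i ] ⟦ φ ⟧∞ (i ∷ s)
  ⟦ ∃∞ᶠ m φ ⟧∞ s     = Σ (Subset (dom w)) λ X →
    (𝓘-rank (dom w ↾ X) ≡ m) × (∀ i → X i → ⟦ φ ⟧∞ (i ∷ s))

  -- Set quantifiers range over the subsets satisfying C.
  module _ (C : ∀ α → Pred (Subset α) 0ℓ) where

    ⟦_⟧ˢ : ∀ {n k} → FOSet A.Carrier n k → Vec Pos n → Vec (Subset (dom w)) k → Set₁
    ⟦ x <ᶠ y ⟧ˢ s S      = Lift _ (dom w [ Vec.lookup s x < Vec.lookup s y ])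
    ⟦ letterᶠ a x ⟧ˢ s S = Lift _ (letter w (Vec.lookup s x) A.≈ a)
    ⟦ x ∈ᶠ X ⟧ˢ s S      = Lift _ (Vec.lookup S X (Vec.lookup s x))
    ⟦ ¬ᶠ φ ⟧ˢ s S        = ¬ ⟦ φ ⟧ˢ s S
    ⟦ φ ∧ᶠ ψ ⟧ˢ s S      = ⟦ φ ⟧ˢ s S × ⟦ ψ ⟧ˢ s S
    ⟦ φ ∨ᶠ ψ ⟧ˢ s S      = ⟦ φ ⟧ˢ s S ⊎ ⟦ ψ ⟧ˢ s S
    ⟦ ∃ᶠ φ ⟧ˢ s S        = ∃[ i ] ⟦ φ ⟧ˢ (i ∷ s) S
    ⟦ ∃ˢ φ ⟧ˢ s S        = Σ (Subset (dom w)) λ X → C (dom w) X × ⟦ φ ⟧ˢ s (X ∷ S)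

data Logic : Set where
  FO[∞] FO[cut] FO[cut]∩WMSO : Logic

module _ {A : Setoid 0ℓ 0ℓ} (L : Language A) where
  private module A = Setoid A

  DefinableFO∞ DefinableFOcut DefinableWMSO : Set₁
  DefinableFO∞   = Σ (FO∞ A.Carrier 0) λ φ → ∀ w → holds L w ⇔ ⟦_⟧∞ w φ []
  DefinableFOcut = Σ (FOSet A.Carrier 0 0) λ φ → ∀ w → holds L w ⇔ ⟦_⟧ˢ w LeftClosed φ [] []
  DefinableWMSO  = Σ (FOSet A.Carrier 0 0) λ φ → ∀ w → holds L w ⇔ ⟦_⟧ˢ w FiniteSubset φ [] []

Definable : {A : Setoid 0ℓ 0ℓ} → Logic → Language A → Set₁
Definable FO[∞]        L = DefinableFO∞ L
Definable FO[cut]      L = DefinableFOcut L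
Definable FO[cut]∩WMSO L = DefinableFOcut L × DefinableWMSO L

{-# OPTIONS --safe #-}

-- Let Ω = ω + ω* and F(x) = (x^Ω)^K, where K is so large that x^K = x^(K+1)
-- for all x.
-- Then F(x)x = xF(x) = F(x), so that x, F(x), F²(x), … decreases in the natural
-- order of idempotents and becomes constant within |M| steps in an aperiodic
-- finite ⊛-monoid M. If it does so within n ≥ 1 steps in M and in N, it also
-- does in M □ N, for a larger K: with e = Fⁿ(m), the second component evaluated
-- in the context (m₁e, em₂) evolves by F itself, because e absorbs every
-- prefix and suffix that occurs. Hence a bound for a finite basis bounds all of
-- its iterated block products, and these do not distinguish the words
-- F⁰(a), F¹(a), F²(a), … from index n on.
--
-- On the other hand Fⁿ(a) has infinitary rank n, which FO[∞] can express. For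
-- the other logics, call positions near of order 0 when they are equal, and of
-- order n + 1 when only finitely many classes of order n meet the interval
-- between them. This finiteness is expressible in WMSO, by a finite set meeting
-- all these classes, and in FO[cut], by the absence of a cut at which they
-- accumulate. All positions of Fⁿ(a) are near of order n + 1, but not all
-- positions of Fⁿ⁺²(a) are.
--
-- Members of a basis are aperiodic because sentences of these logics do not
-- distinguish long finite words over one letter. Excluded middle comes from the
-- basis: the language that is everything or empty according to P is recognized,
-- hence definable, and a sentence can be evaluated on the empty word.
module Submission where

open import Defs
open import Data.Empty using (⊥; ⊥-elim; ⊥-elim-irr)
open import Data.Fin.Base as Fin using (Fin; zero; suc; toℕ; fromℕ<; opposite)
import Data.Fin.Properties as Fin
open import Data.Integer.Base as ℤ using (ℤ; +_; -[1+_])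
import Data.Integer.Properties as ℤ
open import Data.Irrelevant using ([_])
open import Data.List.Base
  using (List; []; _∷_; lookup; map; _++_; concat; tabulate; length; deduplicate)
open import Data.List.Membership.DecPropositional using (_∈?_)
open import Data.List.Membership.Propositional using (_∈_; mapWith∈; find)
import Data.List.Membership.Propositional.Properties as Membership
open import Data.List.Relation.Unary.All as All using (All; []; _∷_)
open import Data.List.Relation.Unary.AllPairs using (_∷_)
open import Data.List.Relation.Unary.Any as Any using (Any; here; there)
import Data.List.Relation.Unary.Any.Properties as Any
open import Data.List.Relation.Unary.Unique.DecPropositional.Properties using (deduplicate-!)
open import Data.List.Relation.Unary.Unique.Propositional using (Unique)
open import Data.Nat.Base as ℕ using (ℕ; zero; suc; s≤s; z<s)
open import Data.Nat.GeneralisedArithmetic using (fold; fold-+)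
import Data.Nat.Properties as ℕ
open import Data.Product.Base using (Σ; ∃; ∃-syntax; _×_; _,_; proj₁; proj₂)
open import Data.Product.Function.NonDependent.Propositional using (_×-⇔_)
open import Data.Refinement as Refinement using (value; value-injective; _,_)
open import Data.Sum.Base using (_⊎_; inj₁; inj₂)
open import Data.Sum.Function.Propositional using (_⊎-⇔_)
open import Data.Unit.Base using (⊤; tt)
open import Data.Vec.Base as Vec using (Vec; []; _∷_)
open import Data.Vec.Relation.Binary.Pointwise.Inductive as Pointwise using (Pointwise; []; _∷_)
open import Function.Base using (_∘_; id; const; case_of_)
open import Function.Bundles using (Equivalence; Func; Inverse; _⇔_; mk⇔; mk↔ₛ′; mk↣)
open import Function.Definitions using (StrictlySurjective)
open import Function.Properties.Equivalence using () renaming (sym to ⇔-sym; trans to ⇔-trans)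
open import Function.Related.TypeIsomorphisms using (→-cong-⇔; ¬-cong-⇔)
open import Level using (Level; Lift; 0ℓ; lift; lower)
open import Relation.Binary.Bundles using (Setoid)
import Relation.Binary.Construct.Flip.EqAndOrd as Flip
open import Relation.Binary.Core using (Rel)
open import Relation.Binary.Definitions
  using (DecidableEquality; Reflexive; Symmetric; Transitive; tri<; tri≈; tri>)
open import Relation.Binary.PropositionalEquality as ≡
  using (_≡_; refl; cong; subst; sym; trans)
import Relation.Binary.Reasoning.Setoid as SetoidReasoning
open import Relation.Binary.Structures using (IsStrictTotalOrder)
open import Relation.Nullary.Decidable as Decidable
  using (Dec; yes; no; ¬?; _×-dec_; _⊎-dec_; decidable-stable; map′; recompute)
open import Relation.Nullary.Negation.Core using (¬_)
open import Relation.Unary using (Pred)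

private
  variable
    c ℓ : Level
-- The order ω + ω*

op : CountableOrder → CountableOrder
op α = record
  { Carrier            = ∣ α ∣
  ; _<_                = λ x y → α [ y < x ]
  ; isStrictTotalOrder = Flip.isStrictTotalOrder (CountableOrder.isStrictTotalOrder α)
  ; countable          = CountableOrder.countable α
  }

ω ω* : CountableOrder
ω = record
  { Carrier            = ℕ
  ; _<_                = ℕ._<_
  ; isStrictTotalOrder = ℕ.<-isStrictTotalOrder
  ; countable          = mk↣ {to = id} id
  }
ω* = op ω

infixl 6 _⊕_
_⊕_ : CountableOrder → CountableOrder → CountableOrder
α ⊕ β = ∑ (ordinal 2) (lookup (α ∷ β ∷ []))

Ω : CountableOrder
Ω = ω ⊕ ω*

pattern lo n = zero , n
pattern hi n = suc zero , n
pattern hi-lo = fst (s≤s ())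

-- The new first point shifts the copy of ω by one and leaves ω* alone. This and its mirror image
-- make `x ^ Ω` absorb `x` on both sides.
1⊕Ω≃Ω : ordinal 1 ⊕ Ω ≃ Ω
1⊕Ω≃Ω = mk≃ to mono surj
  where
  to : ∣ ordinal 1 ⊕ Ω ∣ → ∣ Ω ∣
  to (lo _)      = lo 0
  to (hi (lo n)) = lo (suc n)
  to (hi (hi n)) = hi n

  mono : ∀ {x y} → ordinal 1 ⊕ Ω [ x < y ] → Ω [ to x < to y ]
  mono {lo zero} {lo zero} (snd ())
  mono {lo _} {hi (lo _)} _ = snd z<s
  mono {lo _} {hi (hi _)} _ = fst z<s
  mono {hi _} {lo _} (fst ())
  mono {hi _} {hi _} hi-lo
  mono {hi (lo _)} {hi (lo _)} (snd (snd lt)) = snd (s≤s lt)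
  mono {hi (lo _)} {hi (hi _)} _ = fst z<s
  mono {hi (hi _)} {hi (lo _)} (snd (fst ()))
  mono {hi (hi _)} {hi (hi _)} (snd hi-lo)
  mono {hi (hi _)} {hi (hi _)} (snd (snd lt)) = snd lt

  surj : StrictlySurjective _≡_ to
  surj (lo zero)    = lo zero , refl
  surj (lo (suc n)) = hi (lo n) , refl
  surj (hi n)       = hi (hi n) , refl

Ω⊕1≃Ω : Ω ⊕ ordinal 1 ≃ Ω
Ω⊕1≃Ω = mk≃ to mono surj
  where
  to : ∣ Ω ⊕ ordinal 1 ∣ → ∣ Ω ∣
  to (lo (lo n)) = lo n
  to (lo (hi n)) = hi (suc n)
  to (hi _)      = hi 0

  mono : ∀ {x y} → Ω ⊕ ordinal 1 [ x < y ] → Ω [ to x < to y ]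
  mono {lo (lo _)} {lo (lo _)} (snd (snd lt)) = snd lt
  mono {lo (lo _)} {lo (hi _)} _ = fst z<s
  mono {lo (hi _)} {lo (lo _)} (snd (fst ()))
  mono {lo (hi _)} {lo (hi _)} (snd hi-lo)
  mono {lo (hi _)} {lo (hi _)} (snd (snd lt)) = snd (s≤s lt)
  mono {lo (lo _)} {hi _} _ = fst z<s
  mono {lo (hi _)} {hi _} _ = snd z<s
  mono {hi _} {lo _} (fst ())
  mono {hi _} {hi _} hi-lo
  mono {hi zero} {hi zero} (snd ())

  surj : StrictlySurjective _≡_ to
  surj (lo n)       = lo (lo n) , refl
  surj (hi zero)    = hi zero , refl
  surj (hi (suc n)) = lo (hi n) , refl

-- Each position of `Ω` has finitely many points on one side and a copy of `Ω` on the other. Hence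
-- only finite powers and `Ω`-powers occur as prefixes and suffixes when an `Ω`-power is computed in
-- a block product.
before-lo : ∀ n → ordinal n ≃ Ω ↾ λ x → Ω [ x < lo n ]
before-lo n = mk≃ (λ k → lo (toℕ k) , [ snd (Fin.toℕ<n k) ]) (λ lt → snd lt) surj
  where
  surj : StrictlySurjective _≡_ _
  -- The membership proof is irrelevant, so a usable one is recovered by deciding the order.
  surj (lo k , [ p ]) with recompute (CountableOrder._<?_ Ω (lo k) (lo n)) p
  ... | snd k<n = fromℕ< k<n , value-injective (cong lo (Fin.toℕ-fromℕ< k<n))
  surj (hi k , [ p ]) with recompute (CountableOrder._<?_ Ω (hi k) (lo n)) p
  ... | fst ()

before-hi : ∀ n → Ω ≃ Ω ↾ λ x → Ω [ x < hi n ]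
before-hi n = mk≃ to mono surj
  where
  to : ∣ Ω ∣ → _
  to (lo k) = lo k , [ fst z<s ]
  to (hi k) = hi (suc n ℕ.+ k) , [ snd (s≤s (ℕ.m≤m+n n k)) ]

  mono : ∀ {x y} → Ω [ x < y ] → Ω [ value (to x) < value (to y) ]
  mono {lo _} {lo _} (snd lt) = snd lt
  mono {lo _} {hi _} _        = fst z<s
  mono {hi _} {lo _} (fst ())
  mono {hi _} {hi _} hi-lo
  mono {hi _} {hi _} (snd lt) = snd (ℕ.+-monoʳ-< (suc n) lt)

  surj : StrictlySurjective _≡_ to
  surj (lo k , _) = lo k , refl
  surj (hi k , [ p ]) with recompute (CountableOrder._<?_ Ω (hi k) (hi n)) p
  ... | hi-lo
  ... | snd n<k = hi (k ℕ.∸ suc n) , value-injective (cong hi (ℕ.m+[n∸m]≡n n<k))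

after-lo : ∀ n → Ω ≃ Ω ↾ λ x → Ω [ lo n < x ]
after-lo n = mk≃ to mono surj
  where
  to : ∣ Ω ∣ → _
  to (lo k) = lo (suc n ℕ.+ k) , [ snd (s≤s (ℕ.m≤m+n n k)) ]
  to (hi k) = hi k , [ fst z<s ]

  mono : ∀ {x y} → Ω [ x < y ] → Ω [ value (to x) < value (to y) ]
  mono {lo _} {lo _} (snd lt) = snd (ℕ.+-monoʳ-< (suc n) lt)
  mono {lo _} {hi _} _        = fst z<s
  mono {hi _} {lo _} (fst ())
  mono {hi _} {hi _} hi-lo
  mono {hi _} {hi _} (snd lt) = snd lt

  surj : StrictlySurjective _≡_ to
  surj (hi k , _) = hi k , refl
  surj (lo k , [ p ]) with recompute (CountableOrder._<?_ Ω (lo n) (lo k)) p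
  ... | fst ()
  ... | snd n<k = lo (k ℕ.∸ suc n) , value-injective (cong lo (ℕ.m+[n∸m]≡n n<k))

-- Positions `hi k` are counted from the right end, hence the reversal by `opposite`.
after-hi : ∀ n → ordinal n ≃ Ω ↾ λ x → Ω [ hi n < x ]
after-hi n = mk≃ (λ k → hi (toℕ (opposite k)) , [ snd (Fin.toℕ<n (opposite k)) ])
                 (λ lt → snd (mono lt)) surj
  where
  mono : ∀ {j k} → j Fin.< k → opposite k Fin.< opposite j
  mono {j} {k} j<k = ≡.subst₂ ℕ._<_
    (sym (Fin.opposite-prop k)) (sym (Fin.opposite-prop j))
    (ℕ.∸-monoʳ-< (s≤s j<k) (Fin.toℕ<n k))

  surj : StrictlySurjective _≡_ _
  surj (lo k , [ p ]) with recompute (CountableOrder._<?_ Ω (hi n) (lo k)) p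
  ... | fst ()
  surj (hi k , [ p ]) with recompute (CountableOrder._<?_ Ω (hi n) (hi k)) p
  ... | hi-lo
  ... | snd k<n = opposite (fromℕ< k<n) ,
    value-injective (cong hi (trans (cong toℕ (Fin.opposite-involutive (fromℕ< k<n)))
                                    (Fin.toℕ-fromℕ< k<n)))

-- Powers in ⊛-monoids

1⊕ordinal≃ : ∀ n → ordinal 1 ⊕ ordinal n ≃ ordinal (suc n)
1⊕ordinal≃ n = mk≃ to mono surj
  where
  to : ∣ ordinal 1 ⊕ ordinal n ∣ → Fin (suc n)
  to (lo _) = zero
  to (hi k) = suc k

  mono : ∀ {x y} → ordinal 1 ⊕ ordinal n [ x < y ] → to x Fin.< to y
  mono {lo zero} {lo zero} (snd ())
  mono {lo _} {hi _} _ = z<s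
  mono {hi _} {lo _} (fst ())
  mono {hi _} {hi _} hi-lo
  mono {hi _} {hi _} (snd lt) = s≤s lt

  surj : StrictlySurjective _≡_ to
  surj zero    = lo zero , refl
  surj (suc k) = hi k , refl

module Powers (M : ⊛Monoid c ℓ) where
  open ⊛Monoid M
  open ⊛MonoidProperties M
  open SetoidReasoning setoid

  infixr 8 _^_ _^⁺_
  _^_ : Carrier → CountableOrder → Carrier
  x ^ α = π (word α (const x))

  -- x ^⁺ n has n + 1 factors.
  _^⁺_ : Carrier → ℕ → Carrier
  x ^⁺ zero  = x
  x ^⁺ suc n = x · (x ^⁺ n)

  ^-congˡ : ∀ {x y} α → x ≈ y → x ^ α ≈ y ^ α
  ^-congˡ α eq = π-cong (≅-letters (const eq))

  ^-congʳ : ∀ x {α β} → α ≃ β → x ^ α ≈ x ^ β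
  ^-congʳ x f = π-cong (f , λ _ → ≈-refl)

  ^⁺-cong : ∀ {x y} n → x ≈ y → x ^⁺ n ≈ y ^⁺ n
  ^⁺-cong zero    eq = eq
  ^⁺-cong (suc n) eq = ·-cong eq (^⁺-cong n eq)

  ^-⊕ : ∀ x α β → x ^ (α ⊕ β) ≈ x ^ α · x ^ β
  ^-⊕ x α β = ≈-trans
    (π-∏ (ordinal 2) λ i → word (lookup (α ∷ β ∷ []) i) (const x))
    (π-cong (≅-letters λ { zero → ≈-refl ; (suc zero) → ≈-refl }))

  ^-1 : ∀ x → x ^ ordinal 1 ≈ x
  ^-1 x = ≈-trans (π-cong (≅-letters λ { zero → ≈-refl })) (π-unit x)

  ^-suc : ∀ x n → x ^ ordinal (suc n) ≈ x · x ^ ordinal n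
  ^-suc x n = begin
    x ^ ordinal (suc n)           ≈⟨ ^-congʳ x (1⊕ordinal≃ n) ⟨
    x ^ (ordinal 1 ⊕ ordinal n)   ≈⟨ ^-⊕ x _ _ ⟩
    x ^ ordinal 1 · x ^ ordinal n ≈⟨ ·-cong (^-1 x) ≈-refl ⟩
    x · x ^ ordinal n             ∎

  ^-ordinal : ∀ x n → x ^ ordinal (suc n) ≈ x ^⁺ n
  ^-ordinal x zero    = ^-1 x
  ^-ordinal x (suc n) = ≈-trans (^-suc x (suc n)) (·-cong ≈-refl (^-ordinal x n))

  -- Stated for any word with empty domain because the prefix of a first position and the suffix of
  -- a last one are restrictions, not literally `⟪ [] ⟫`.
  ·-identityʳ : ∀ x (u : Word setoid) → ¬ ∣ dom u ∣ → x · π u ≈ x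
  ·-identityʳ x u ∅ = begin
    x · π u                                            ≈⟨ ·-cong (π-unit x) ≈-refl ⟨
    π ⟪ x ∷ [] ⟫ · π u                                 ≈⟨ π-++ _ _ ⟨
    π (∏ (ordinal 2) (lookup (⟪ x ∷ [] ⟫ ∷ u ∷ [])))   ≈⟨ π-cong iso ⟨
    π ⟪ x ∷ [] ⟫                                       ≈⟨ π-unit x ⟩
    x                                                  ∎
    where
    iso : ⟪ x ∷ [] ⟫ ≅ ∏ (ordinal 2) (lookup (⟪ x ∷ [] ⟫ ∷ u ∷ []))
    iso = mk≃ (zero ,_) snd (λ { (lo k) → k , refl ; (hi k) → ⊥-elim (∅ k) })
        , λ { zero → ≈-refl }

  ·-identityˡ : ∀ x (u : Word setoid) → ¬ ∣ dom u ∣ → π u · x ≈ x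
  ·-identityˡ x u ∅ = begin
    π u · x                                            ≈⟨ ·-cong ≈-refl (π-unit x) ⟨
    π u · π ⟪ x ∷ [] ⟫                                 ≈⟨ π-++ _ _ ⟨
    π (∏ (ordinal 2) (lookup (u ∷ ⟪ x ∷ [] ⟫ ∷ [])))   ≈⟨ π-cong iso ⟨
    π ⟪ x ∷ [] ⟫                                       ≈⟨ π-unit x ⟩
    x                                                  ∎
    where
    iso : ⟪ x ∷ [] ⟫ ≅ ∏ (ordinal 2) (lookup (u ∷ ⟪ x ∷ [] ⟫ ∷ []))
    iso = mk≃ (suc zero ,_) snd (λ { (lo k) → ⊥-elim (∅ k) ; (hi k) → k , refl })
        , λ { zero → ≈-refl }

  x·x^Ω≈x^Ω : ∀ x → x · x ^ Ω ≈ x ^ Ω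
  x·x^Ω≈x^Ω x = begin
    x · x ^ Ω             ≈⟨ ·-cong (^-1 x) ≈-refl ⟨
    x ^ ordinal 1 · x ^ Ω ≈⟨ ^-⊕ x _ _ ⟨
    x ^ (ordinal 1 ⊕ Ω)   ≈⟨ ^-congʳ x 1⊕Ω≃Ω ⟩
    x ^ Ω                 ∎

  x^Ω·x≈x^Ω : ∀ x → x ^ Ω · x ≈ x ^ Ω
  x^Ω·x≈x^Ω x = begin
    x ^ Ω · x             ≈⟨ ·-cong ≈-refl (^-1 x) ⟨
    x ^ Ω · x ^ ordinal 1 ≈⟨ ^-⊕ x _ _ ⟨
    x ^ (Ω ⊕ ordinal 1)   ≈⟨ ^-congʳ x Ω⊕1≃Ω ⟩
    x ^ Ω                 ∎

  ^⁺-homo : ∀ x m n → x ^⁺ m · x ^⁺ n ≈ x ^⁺ (suc m ℕ.+ n)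
  ^⁺-homo x zero    n = ≈-refl
  ^⁺-homo x (suc m) n = ≈-trans (·-assoc _ _ _) (·-cong ≈-refl (^⁺-homo x m n))

  ^⁺-comm : ∀ x n → x ^⁺ n · x ≈ x · x ^⁺ n
  ^⁺-comm x zero    = ≈-refl
  ^⁺-comm x (suc n) = ≈-trans (·-assoc _ _ _) (·-cong ≈-refl (^⁺-comm x n))

  idem-^⁺ : ∀ {e} → e · e ≈ e → ∀ n → e ^⁺ n ≈ e
  idem-^⁺ ee zero    = ≈-refl
  idem-^⁺ ee (suc n) = ≈-trans (·-cong ≈-refl (idem-^⁺ ee n)) ee

  -- The natural order of idempotents when both arguments are idempotent.
  infix 4 _≼_
  _≼_ : Carrier → Carrier → Set ℓ
  e ≼ x = (e · x ≈ e) × (x · e ≈ e)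

  ≼-respˡ : ∀ {e e′ x} → e ≈ e′ → e ≼ x → e′ ≼ x
  ≼-respˡ eq (l , r) =
    ≈-trans (·-cong (≈-sym eq) ≈-refl) (≈-trans l eq) ,
    ≈-trans (·-cong ≈-refl (≈-sym eq)) (≈-trans r eq)

  ≼-respʳ : ∀ {e x x′} → x ≈ x′ → e ≼ x → e ≼ x′
  ≼-respʳ eq (l , r) =
    ≈-trans (·-cong ≈-refl (≈-sym eq)) l , ≈-trans (·-cong (≈-sym eq) ≈-refl) r

  ≼-trans : ∀ {e d x} → e ≼ d → d ≼ x → e ≼ x
  ≼-trans {e} {d} {x} (ed , de) (dx , xd) =
    (begin
      e · x       ≈⟨ ·-cong ed ≈-refl ⟨
      (e · d) · x ≈⟨ ·-assoc _ _ _ ⟩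
      e · (d · x) ≈⟨ ·-cong ≈-refl dx ⟩
      e · d       ≈⟨ ed ⟩
      e           ∎) ,
    (begin
      x · e       ≈⟨ ·-cong ≈-refl de ⟨
      x · (d · e) ≈⟨ ·-assoc _ _ _ ⟨
      (x · d) · e ≈⟨ ·-cong xd ≈-refl ⟩
      d · e       ≈⟨ de ⟩
      e           ∎)

  ≼-· : ∀ {e x y} → e ≼ x → e ≼ y → e ≼ x · y
  ≼-· (ex , xe) (ey , ye) =
    ≈-trans (≈-sym (·-assoc _ _ _)) (≈-trans (·-cong ex ≈-refl) ey) ,
    ≈-trans (·-assoc _ _ _) (≈-trans (·-cong ≈-refl ye) xe)

  ≼-^⁺ : ∀ {e x} → e ≼ x → ∀ n → e ≼ x ^⁺ n
  ≼-^⁺ p zero    = p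
  ≼-^⁺ p (suc n) = ≼-· p (≼-^⁺ p n)

  ≼-^ordinal : ∀ {e x} → e ≼ x → ∀ n → e ≼ x ^ ordinal n
  ≼-^ordinal p zero    = ·-identityʳ _ _ (λ ()) , ·-identityˡ _ _ (λ ())
  ≼-^ordinal p (suc n) with ≼-· p (≼-^ordinal p n)
  ... | l , r = ≈-trans (·-cong ≈-refl (^-suc _ n)) l , ≈-trans (·-cong (^-suc _ n) ≈-refl) r

  Aperiodic : ℕ → Set _
  Aperiodic K = ∀ x → x ^⁺ suc K ≈ x ^⁺ K

  aperiodic-≤ : ∀ {K L} → Aperiodic K → K ℕ.≤′ L → ∀ x → x ^⁺ L ≈ x ^⁺ K
  aperiodic-≤ ap (ℕ.≤′-reflexive refl) x = ≈-refl
  aperiodic-≤ {K} ap (ℕ.≤′-step {L} K≤L) x = begin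
    x · x ^⁺ L ≈⟨ ·-cong ≈-refl (aperiodic-≤ ap K≤L x) ⟩
    x · x ^⁺ K ≈⟨ ap x ⟩
    x ^⁺ K     ∎

  -- Block products only allow a comparison of middle factors between two absorbing ones. The three
  -- powers of K + 1 factors add up to 3K + 3 factors, which is exponent 3K + 2 for `^⁺`.
  sandwich⇒aperiodic : ∀ K →
    (∀ x → x ^⁺ K · (x ^⁺ suc K · x ^⁺ K) ≈ x ^⁺ K · (x ^⁺ K · x ^⁺ K)) →
    Aperiodic (suc K ℕ.+ (suc K ℕ.+ K))
  sandwich⇒aperiodic K eq x = begin
    x ^⁺ suc (suc K ℕ.+ (suc K ℕ.+ K))      ≡⟨ cong (x ^⁺_) (ℕ.+-suc (suc K) (suc K ℕ.+ K)) ⟨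
    x ^⁺ (suc K ℕ.+ (suc (suc K) ℕ.+ K))    ≈⟨ ^⁺-homo x K _ ⟨
    x ^⁺ K · x ^⁺ (suc (suc K) ℕ.+ K)       ≈⟨ ·-cong ≈-refl (^⁺-homo x (suc K) K) ⟨
    x ^⁺ K · (x ^⁺ suc K · x ^⁺ K)          ≈⟨ eq x ⟩
    x ^⁺ K · (x ^⁺ K · x ^⁺ K)              ≈⟨ ·-cong ≈-refl (^⁺-homo x K K) ⟩
    x ^⁺ K · x ^⁺ (suc K ℕ.+ K)             ≈⟨ ^⁺-homo x K _ ⟩
    x ^⁺ (suc K ℕ.+ (suc K ℕ.+ K))          ∎

  -- The map F with K + 1 factors in the outer power; `iter` is its n-fold iterate.
  step : ℕ → Carrier → Carrier
  step K x = (x ^ Ω) ^⁺ K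

  iter : ℕ → ℕ → Carrier → Carrier
  iter K n x = fold x (step K) n

  step-cong : ∀ K {x y} → x ≈ y → step K x ≈ step K y
  step-cong K eq = ^⁺-cong K (^-congˡ Ω eq)

  iter-cong : ∀ K n {x y} → x ≈ y → iter K n x ≈ iter K n y
  iter-cong K zero    eq = eq
  iter-cong K (suc n) eq = step-cong K (iter-cong K n eq)

  -- The left side of the hypothesis is `x ^ Ω`, by absorption, and the right side is `x`, by
  -- idempotence. The sandwiched form is the one that `sandwich` provides.
  idem⇒step-fixed : ∀ K {x} → x · x ≈ x → x · (x ^ Ω · x) ≈ x · (x ^⁺ K · x) → step K x ≈ x
  idem⇒step-fixed K {x} xx eq = begin
    (x ^ Ω) ^⁺ K             ≈⟨ ^⁺-cong K (≈-trans (·-cong ≈-refl (x^Ω·x≈x^Ω x)) (x·x^Ω≈x^Ω x)) ⟨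
    (x · (x ^ Ω · x)) ^⁺ K   ≈⟨ ^⁺-cong K eq ⟩
    (x · (x ^⁺ K · x)) ^⁺ K  ≈⟨ ^⁺-cong K (·-cong ≈-refl (·-cong (idem-^⁺ xx K) ≈-refl)) ⟩
    (x · (x · x)) ^⁺ K       ≈⟨ ^⁺-cong K (≈-trans (·-cong ≈-refl xx) xx) ⟩
    x ^⁺ K                   ≈⟨ idem-^⁺ xx K ⟩
    x                        ∎

  -- The number n of iterations has to be the same for all iterated block products; the exponent K
  -- may grow with each of them.
  record Stable (n K : ℕ) : Set (c Level.⊔ ℓ) where
    field
      aperiodic : Aperiodic K
      stable    : ∀ x → iter K (suc n) x ≈ iter K n x

  module _ {K} (ap : Aperiodic K) where

    ^⁺-≼ : ∀ x → x ^⁺ K ≼ x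
    ^⁺-≼ x = ≈-trans (^⁺-comm x K) (ap x) , ap x

    ^⁺-idem : ∀ x → x ^⁺ K · x ^⁺ K ≈ x ^⁺ K
    ^⁺-idem x = proj₁ (≼-^⁺ (^⁺-≼ x) K)

    step-≼^Ω : ∀ x → step K x ≼ x ^ Ω
    step-≼^Ω x = ^⁺-≼ (x ^ Ω)

    ^Ω-≼ : ∀ x → x ^ Ω ≼ x
    ^Ω-≼ x = x^Ω·x≈x^Ω x , x·x^Ω≈x^Ω x

    -- F(x) lies below `x ^ Ω`, which lies below x, so further iterates only descend.
    iter-≼ : ∀ n x → iter K (suc n) x ≼ x ^ Ω
    iter-≼ zero    x = step-≼^Ω x
    iter-≼ (suc n) x =
      ≼-trans (step-≼^Ω (iter K (suc n) x)) (≼-trans (^Ω-≼ _) (iter-≼ n x))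

    -- The product of `e ^ Ω` and e is `e ^ Ω` by absorption, and it is e because e is F(e), which
    -- lies below `e ^ Ω`. Idempotence holds because e is a value of F.
    step-fixed : ∀ {e} → step K e ≈ e → (e ^ Ω ≈ e) × (∀ L → e ^⁺ L ≈ e)
    step-fixed {e} fix = e^Ω≈e , idem-^⁺ ee
      where
      e^Ω≈e : e ^ Ω ≈ e
      e^Ω≈e = begin
        e ^ Ω               ≈⟨ x^Ω·x≈x^Ω e ⟨
        e ^ Ω · e           ≈⟨ ·-cong ≈-refl fix ⟨
        e ^ Ω · step K e    ≈⟨ proj₂ (step-≼^Ω e) ⟩
        step K e            ≈⟨ fix ⟩
        e                   ∎
      ee : e · e ≈ e
      ee = ≈-trans (≈-sym (·-cong fix fix)) (≈-trans (^⁺-idem (e ^ Ω)) fix)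

    step-≤ : ∀ {L} → K ℕ.≤′ L → ∀ n x → iter L n x ≈ iter K n x
    step-≤ K≤L zero    x = ≈-refl
    step-≤ K≤L (suc n) x = ≈-trans (aperiodic-≤ ap K≤L _) (step-cong K (step-≤ K≤L n x))

  -- Powers are constant from exponent K on, so a larger exponent yields the same map F. This lets
  -- both factors of a block product share an exponent.
  stable-≤ : ∀ {n K L} → Stable n K → K ℕ.≤′ L → Stable n L
  stable-≤ {n} {K} {L} S K≤L = record
    { aperiodic = λ x → ≈-trans (aperiodic-≤ aperiodic (ℕ.≤′-step K≤L) x)
                                (≈-sym (aperiodic-≤ aperiodic K≤L x))
    ; stable    = λ x → ≈-trans (step-≤ aperiodic K≤L (suc n) x)
                          (≈-trans (stable x) (≈-sym (step-≤ aperiodic K≤L n x)))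
    }
    where open Stable S

  stable-suc : ∀ {n K} → Stable n K → Stable (suc n) K
  stable-suc {K = K} S = record { aperiodic = aperiodic ; stable = λ x → step-cong K (stable x) }
    where open Stable S

  stable-+ : ∀ {n K} → Stable n K → ∀ m x → iter K (m ℕ.+ n) x ≈ iter K n x
  stable-+         S zero    x = ≈-refl
  stable-+ {n} {K} S (suc m) x =
    ≈-trans (step-cong K (stable-+ S m x)) (Stable.stable S x)

  -- Two of the first s + 1 iterates coincide by the pigeonhole principle. Since the iterates
  -- descend, the earlier of the two already equals its successor, and this persists.
  finite⇒stable : ∀ {s K} → Inverse setoid (≡.setoid (Fin s)) → Aperiodic K → Stable s K
  finite⇒stable {s} {K} inv ap = record { aperiodic = ap ; stable = stab }
    where
    module I = Inverse inv

    to-injective : ∀ {x y} → I.to x ≡ I.to y → x ≈ y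
    to-injective eq =
      ≈-trans (≈-sym (I.strictlyInverseʳ _)) (≈-trans (I.from-cong eq) (I.strictlyInverseʳ _))

    iter-+-≼ : ∀ m n x → iter K (suc m ℕ.+ n) x ≼ iter K n x
    iter-+-≼ m n x = ≡.subst (_≼ iter K n x) (sym (fold-+ x (step K) (suc m)))
      (≼-trans (iter-≼ {K} ap m (iter K n x)) (^Ω-≼ {K} ap _))

    repeats : ∀ i d x → iter K (d ℕ.+ suc i) x ≈ iter K i x → iter K (suc i) x ≈ iter K i x
    repeats i zero    x eq = eq
    -- The iterates at `i` and `suc i` lie below each other, so their product equals both.
    repeats i (suc d) x eq =
      ≈-trans (≈-sym (proj₂ (iter-+-≼ 0 i x))) (proj₁ (≼-respˡ eq (iter-+-≼ d (suc i) x)))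

    persists : ∀ {i} m x → iter K (suc i) x ≈ iter K i x →
               iter K (suc (m ℕ.+ i)) x ≈ iter K (m ℕ.+ i) x
    persists zero    x eq = eq
    persists (suc m) x eq = step-cong K (persists m x eq)

    stab : ∀ x → iter K (suc s) x ≈ iter K s x
    stab x with Fin.pigeonhole (ℕ.n<1+n s) (λ i → I.to (iter K (toℕ i) x))
    ... | i , j , i<j , eq =
      subst (λ k → iter K (suc k) x ≈ iter K k x) (ℕ.m∸n+n≡m i≤s)
        (persists (s ℕ.∸ toℕ i) x (repeats (toℕ i) (toℕ j ℕ.∸ suc (toℕ i)) x
          (subst (λ k → iter K k x ≈ iter K (toℕ i) x) (sym (ℕ.m∸n+n≡m i<j))
            (≈-sym (to-injective eq)))))
      where
      i≤s : toℕ i ℕ.≤ s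
      i≤s = ℕ.s≤s⁻¹ (Fin.toℕ<n i)

-- Stability of block products

module BlockStability (M N : ⊛Monoid 0ℓ 0ℓ) where
  private
    module M where
      open ⊛Monoid M public
      open ⊛MonoidProperties M public
      open Powers M public
    module N where
      open ⊛Monoid N public
      open ⊛MonoidProperties N public
      open Powers N public

  -- Opacity keeps the type checker from unfolding products in M □ N.
  opaque
    P : ⊛Monoid 0ℓ 0ℓ
    P = M □ N

    P≡□ : P ≡ M □ N
    P≡□ = refl

  private
    module P where
      open ⊛Monoid P public
      open ⊛MonoidProperties P public
      open Powers P public

  opaque
    unfolding P

    π₁ : P.Carrier → M.Carrier
    π₁ = proj₁

    infix 9 _⟨_,_⟩
    _⟨_,_⟩ : P.Carrier → M.Carrier → M.Carrier → N.Carrier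
    p ⟨ m₁ , m₂ ⟩ = Func.to (proj₂ p) (m₁ , m₂)

    ≈-intro : ∀ {p q} → π₁ p M.≈ π₁ q → (∀ m₁ m₂ → p ⟨ m₁ , m₂ ⟩ N.≈ q ⟨ m₁ , m₂ ⟩) → p P.≈ q
    ≈-intro eq₁ eq₂ = eq₁ , λ (m₁ , m₂) → eq₂ m₁ m₂

    ⟨⟩-cong : ∀ p {m₁ m₁′ m₂ m₂′} → m₁ M.≈ m₁′ → m₂ M.≈ m₂′ →
              p ⟨ m₁ , m₂ ⟩ N.≈ p ⟨ m₁′ , m₂′ ⟩
    ⟨⟩-cong p eq₁ eq₂ = Func.cong (proj₂ p) (eq₁ , eq₂)

    π₁-^ : ∀ p α → π₁ (p P.^ α) M.≈ π₁ p M.^ α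
    π₁-^ p α = M.≈-refl

    π₁-· : ∀ p q → π₁ (p P.· q) M.≈ π₁ p M.· π₁ q
    π₁-· p q = M.π-cong (≅-letters λ { zero → M.≈-refl ; (suc zero) → M.≈-refl })

    ·-⟨⟩ : ∀ p q m₁ m₂ → (p P.· q) ⟨ m₁ , m₂ ⟩ N.≈
           p ⟨ m₁ , π₁ q M.· m₂ ⟩ N.· q ⟨ m₁ M.· π₁ p , m₂ ⟩
    ·-⟨⟩ p q m₁ m₂ = N.π-cong (≅-letters λ
      { zero       → ⟨⟩-cong p (M.·-identityʳ _ _ λ { (zero , [ () ]) ; (suc _ , [ () ]) })
                               (M.·-cong (singleton after₀ λ _ → refl) M.≈-refl)
      ; (suc zero) → ⟨⟩-cong q (M.·-cong M.≈-refl (singleton before₁ λ _ → refl))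
                               (M.·-identityˡ _ _ λ
        { (zero , [ () ]) ; (suc zero , [ p ]) → ⊥-elim-irr (ℕ.n≮n 1 p) })
      })
      where
      singleton : ∀ {w : Word M.setoid} {m} (f : ordinal 1 ≃ dom w) →
                  (∀ k → letter w (_≃_.to f k) ≡ m) → M.π w M.≈ m
      singleton {w} {m} f eq = M.≈-trans
        (M.≈-sym (M.π-cong {u = ⟪ m ∷ [] ⟫} (f , λ { zero → M.reflexive (sym (eq zero)) })))
        (M.π-unit m)

      after₀ : ordinal 1 ≃ ordinal 2 ↾ λ k → ordinal 2 [ zero < k ]
      after₀ = mk≃ (λ _ → suc zero , [ z<s ]) (λ { {zero} {zero} () })
                   λ { (zero , [ () ]) ; (suc zero , _) → zero , refl }

      before₁ : ordinal 1 ≃ ordinal 2 ↾ λ k → ordinal 2 [ k < suc zero ]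
      before₁ = mk≃ (λ _ → zero , [ z<s ]) (λ { {zero} {zero} () })
                    λ { (zero , _) → zero , refl ; (suc zero , [ p ]) → ⊥-elim-irr (ℕ.n≮n 1 p) }

    ^-⟨⟩ : ∀ p α m₁ m₂ → (p P.^ α) ⟨ m₁ , m₂ ⟩ N.≈ N.π (word α λ i →
      p ⟨ m₁ M.· π₁ p M.^ (α ↾ λ j → α [ j < i ]) , π₁ p M.^ (α ↾ λ j → α [ i < j ]) M.· m₂ ⟩)
    ^-⟨⟩ p α m₁ m₂ = N.≈-refl

  π₁-^⁺ : ∀ p n → π₁ (p P.^⁺ n) M.≈ π₁ p M.^⁺ n
  π₁-^⁺ p zero    = M.≈-refl
  π₁-^⁺ p (suc n) = M.≈-trans (π₁-· p (p P.^⁺ n)) (M.·-cong M.≈-refl (π₁-^⁺ p n))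

  -- Once e absorbs the first component, all the conjugations of the second
  -- one that occur in a power disappear in the context (m₁ e , e m₂).
  module _ {e : M.Carrier} (m₁ m₂ : M.Carrier) where
    ev : P.Carrier → N.Carrier
    ev p = p ⟨ m₁ M.· e , e M.· m₂ ⟩

    absorbˡ : ∀ {m} → e M.· m M.≈ e → (m₁ M.· e) M.· m M.≈ m₁ M.· e
    absorbˡ eq = M.≈-trans (M.·-assoc _ _ _) (M.·-cong M.≈-refl eq)

    absorbʳ : ∀ {m} → m M.· e M.≈ e → m M.· (e M.· m₂) M.≈ e M.· m₂
    absorbʳ eq = M.≈-trans (M.≈-sym (M.·-assoc _ _ _)) (M.·-cong eq M.≈-refl)

    ev-· : ∀ p q → e M.≼ π₁ p → e M.≼ π₁ q → ev (p P.· q) N.≈ ev p N.· ev q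
    ev-· p q (ep , _) (_ , qe) = N.≈-trans (·-⟨⟩ p q _ _)
      (N.·-cong (⟨⟩-cong p M.≈-refl (absorbʳ qe)) (⟨⟩-cong q (absorbˡ ep) M.≈-refl))

    ev-^⁺ : ∀ p → e M.≼ π₁ p → ∀ n → ev (p P.^⁺ n) N.≈ ev p N.^⁺ n
    ev-^⁺ p ab zero    = N.≈-refl
    ev-^⁺ p ab (suc n) = N.≈-trans
      (ev-· p (p P.^⁺ n) ab (M.≼-respʳ (M.≈-sym (π₁-^⁺ p n)) (M.≼-^⁺ ab n)))
      (N.·-cong N.≈-refl (ev-^⁺ p ab n))

    -- On one side of a position of `Ω` there is a finite power, absorbed by `ab`, and on the other
    -- an `Ω`-power, absorbed by `abΩ`.
    ev-^Ω : ∀ p → e M.≼ π₁ p → e M.≼ π₁ p M.^ Ω → ev (p P.^ Ω) N.≈ ev p N.^ Ω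
    ev-^Ω p ab abΩ = N.≈-trans (^-⟨⟩ p Ω _ _) (N.π-cong (≅-letters λ i →
      ⟨⟩-cong p (absorbˡ (before-absorbed i)) (absorbʳ (after-absorbed i))))
      where
      absorbed : ∀ {α β} → α ≃ β → e M.≼ π₁ p M.^ α → e M.≼ π₁ p M.^ β
      absorbed f = M.≼-respʳ (M.^-congʳ _ f)

      before-absorbed : ∀ i → e M.· π₁ p M.^ (Ω ↾ λ j → Ω [ j < i ]) M.≈ e
      before-absorbed (lo n) = proj₁ (absorbed (before-lo n) (M.≼-^ordinal ab n))
      before-absorbed (hi n) = proj₁ (absorbed (before-hi n) abΩ)

      after-absorbed : ∀ i → π₁ p M.^ (Ω ↾ λ j → Ω [ i < j ]) M.· e M.≈ e
      after-absorbed (lo n) = proj₂ (absorbed (after-lo n) abΩ)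
      after-absorbed (hi n) = proj₂ (absorbed (after-hi n) (M.≼-^ordinal ab n))

  -- Between two copies of p, the middle factor is evaluated exactly in contexts of the form (m₁ e,
  -- e m₂), where e is the first component of p.
  sandwich : ∀ p {q q′} → π₁ q M.≈ π₁ q′ →
             (∀ m₁ m₂ → ev {π₁ p} m₁ m₂ q N.≈ ev m₁ m₂ q′) →
             p P.· (q P.· p) P.≈ p P.· (q′ P.· p)
  sandwich p {q} {q′} eq₁ eq₂ = ≈-intro
    (M.≈-trans (π₁-· p (q P.· p))
      (M.≈-trans (M.·-cong M.≈-refl fst≈) (M.≈-sym (π₁-· p (q′ P.· p)))))
    λ m₁ m₂ → N.≈-trans (expand q m₁ m₂) (N.≈-trans
      (N.·-cong (⟨⟩-cong p M.≈-refl (M.·-cong fst≈ M.≈-refl))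
        (N.·-cong (eq₂ m₁ m₂) (⟨⟩-cong p (M.·-cong M.≈-refl eq₁) M.≈-refl)))
      (N.≈-sym (expand q′ m₁ m₂)))
    where
    fst≈ : π₁ (q P.· p) M.≈ π₁ (q′ P.· p)
    fst≈ = M.≈-trans (π₁-· q p) (M.≈-trans (M.·-cong eq₁ M.≈-refl) (M.≈-sym (π₁-· q′ p)))

    expand : ∀ r m₁ m₂ → (p P.· (r P.· p)) ⟨ m₁ , m₂ ⟩ N.≈
      p ⟨ m₁ , π₁ (r P.· p) M.· m₂ ⟩ N.·
      (ev {π₁ p} m₁ m₂ r N.· p ⟨ (m₁ M.· π₁ p) M.· π₁ r , m₂ ⟩)
    expand r m₁ m₂ = N.≈-trans (·-⟨⟩ p (r P.· p) m₁ m₂)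
      (N.·-cong N.≈-refl (·-⟨⟩ r p _ m₂))

  module _ {n K} (SM : M.Stable (suc n) K) (SN : N.Stable (suc n) K) where
    private
      module SM = M.Stable SM
      module SN = N.Stable SN

    K′ : ℕ
    K′ = suc K ℕ.+ (suc K ℕ.+ K)

    aperiodic : P.Aperiodic K′
    -- The outer factor is `p ^⁺ K` because its first component absorbs that of p. In its contexts,
    -- powers of p become powers in N, which is aperiodic.
    aperiodic = P.sandwich⇒aperiodic K λ p →
      sandwich (p P.^⁺ K) {p P.^⁺ suc K} {p P.^⁺ K} (fst≈ p) (snd≈ p)
      where
      module _ (p : P.Carrier) where
        e : P.Carrier
        e = p P.^⁺ K

        fst≈ : π₁ (p P.^⁺ suc K) M.≈ π₁ (p P.^⁺ K)
        fst≈ = M.≈-trans (π₁-^⁺ p (suc K))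
          (M.≈-trans (SM.aperiodic (π₁ p)) (M.≈-sym (π₁-^⁺ p K)))

        ab : π₁ e M.≼ π₁ p
        ab = M.≼-respˡ (M.≈-sym (π₁-^⁺ p K)) (M.^⁺-≼ {K} SM.aperiodic (π₁ p))

        snd≈ : ∀ m₁ m₂ → ev {π₁ e} m₁ m₂ (p P.^⁺ suc K) N.≈ ev m₁ m₂ (p P.^⁺ K)
        snd≈ m₁ m₂ = N.≈-trans (ev-^⁺ m₁ m₂ p ab (suc K))
          (N.≈-trans (SN.aperiodic _) (N.≈-sym (ev-^⁺ m₁ m₂ p ab K)))

    K≤K′ : K ℕ.≤′ K′
    K≤K′ = ℕ.≤⇒≤′ (ℕ.m≤n⇒m≤1+n (ℕ.m≤m+n K _))

    SM′ : M.Stable (suc n) K′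
    SM′ = M.stable-≤ SM K≤K′

    SN′ : N.Stable (suc n) K′
    SN′ = N.stable-≤ SN K≤K′

    module _ (p : P.Carrier) where
      private
        e : M.Carrier
        e = M.iter K′ (suc n) (π₁ p)

        p⟨_⟩ : ℕ → P.Carrier
        p⟨ j ⟩ = P.iter K′ j p

      π₁-iter : ∀ j → π₁ p⟨ j ⟩ M.≈ M.iter K′ j (π₁ p)
      π₁-iter zero    = M.≈-refl
      π₁-iter (suc j) = M.≈-trans (π₁-^⁺ _ K′)
        (M.^⁺-cong K′ (M.≈-trans (π₁-^ p⟨ j ⟩ Ω) (M.^-congˡ Ω (π₁-iter j))))

      -- Applying F another n + 1 times to the j-th iterate gives e by stability, and at least one
      -- application of F puts the result below the `Ω`-power of that iterate.
      e≼ : ∀ j → e M.≼ π₁ p⟨ j ⟩ M.^ Ω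
      e≼ j = M.≼-respˡ
        (M.≈-trans (M.iter-cong K′ (suc n) (π₁-iter j))
          (M.≈-trans (M.reflexive (trans (sym (fold-+ (π₁ p) (M.step K′) (suc n) {j}))
                       (cong (λ k → M.iter K′ k (π₁ p)) (ℕ.+-comm (suc n) j))))
            (M.stable-+ SM′ j (π₁ p))))
        (M.iter-≼ {K′} (M.Stable.aperiodic SM′) n (π₁ p⟨ j ⟩))

      ev-iter : ∀ m₁ m₂ j → ev {e} m₁ m₂ p⟨ j ⟩ N.≈ N.iter K′ j (ev {e} m₁ m₂ p)
      ev-iter m₁ m₂ zero    = N.≈-refl {ev {e} m₁ m₂ p}
      ev-iter m₁ m₂ (suc j) = N.≈-trans (ev-^⁺ m₁ m₂ (p⟨ j ⟩ P.^ Ω)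
        (M.≼-respʳ (M.≈-sym (π₁-^ p⟨ j ⟩ Ω)) (e≼ j)) K′)
        (N.^⁺-cong K′ (N.≈-trans
          (ev-^Ω m₁ m₂ p⟨ j ⟩ (M.≼-trans (e≼ j) (M.^Ω-≼ {K′} (M.Stable.aperiodic SM′) _)) (e≼ j))
          (N.^-congˡ Ω (ev-iter m₁ m₂ j))))

      private
        q : P.Carrier
        q = p⟨ suc n ⟩

        q₁≈e : π₁ q M.≈ e
        q₁≈e = π₁-iter (suc n)

        e-fixed : M.step K′ e M.≈ e
        e-fixed = M.Stable.stable SM′ (π₁ p)

        q₁-fixed : (π₁ q M.^ Ω M.≈ π₁ q) × (∀ L → π₁ q M.^⁺ L M.≈ π₁ q)
        q₁-fixed = M.step-fixed {K′} (M.Stable.aperiodic SM′)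
          (M.≈-trans (M.step-cong K′ q₁≈e) (M.≈-trans e-fixed (M.≈-sym q₁≈e)))

        q₁≼q₁^Ω : π₁ q M.≼ π₁ q M.^ Ω
        q₁≼q₁^Ω = M.≼-respˡ (M.≈-sym q₁≈e) (e≼ (suc n))

        q₁≼q₁ : π₁ q M.≼ π₁ q
        q₁≼q₁ = M.≼-trans q₁≼q₁^Ω (M.^Ω-≼ {K′} (M.Stable.aperiodic SM′) _)

        ev-fixed : ∀ m₁ m₂ → let y = ev {π₁ q} m₁ m₂ q in
                   (y N.^ Ω N.≈ y) × (∀ L → y N.^⁺ L N.≈ y)
        ev-fixed m₁ m₂ = N.step-fixed {K′} (N.Stable.aperiodic SN′)
          (N.≈-trans (N.step-cong K′ y≈) (N.≈-trans (N.Stable.stable SN′ _) (N.≈-sym y≈)))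
          where
          y≈ : ev {π₁ q} m₁ m₂ q N.≈ N.iter K′ (suc n) (ev {e} m₁ m₂ p)
          y≈ = N.≈-trans (⟨⟩-cong q (M.·-cong M.≈-refl q₁≈e) (M.·-cong q₁≈e M.≈-refl))
                         (ev-iter m₁ m₂ (suc n))

      -- In the contexts of q, the `Ω`-power and the finite power of q both evaluate to the value of
      -- q itself, and likewise in the first component.
      collapse : q P.· (q P.^ Ω P.· q) P.≈ q P.· (q P.^⁺ K′ P.· q)
      collapse = sandwich q {q P.^ Ω} {q P.^⁺ K′}
        (M.≈-trans (M.≈-trans (π₁-^ q Ω) (proj₁ q₁-fixed))
          (M.≈-sym (M.≈-trans (π₁-^⁺ q K′) (proj₂ q₁-fixed K′))))
        λ m₁ m₂ → N.≈-trans
          (N.≈-trans (ev-^Ω m₁ m₂ q q₁≼q₁ q₁≼q₁^Ω) (proj₁ (ev-fixed m₁ m₂)))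
          (N.≈-sym (N.≈-trans (ev-^⁺ m₁ m₂ q q₁≼q₁ K′) (proj₂ (ev-fixed m₁ m₂) K′)))

    P-stable : P.Stable (suc n) K′
    P-stable = record
        { aperiodic = aperiodic
        -- `q` is a value of F and thus idempotent; `collapse` then makes it a fixed point of F.
        ; stable    = λ p → P.idem⇒step-fixed K′
            (P.^⁺-idem {K′} aperiodic (P.iter K′ n p P.^ Ω)) (collapse p)
        }

    □-stable : Powers.Stable (M □ N) (suc n) K′
    □-stable = subst (λ Q → Powers.Stable Q (suc n) K′) P≡□ P-stable

-- Nearness and infinitary rank

infix 4 _↪_
record _↪_ (α β : CountableOrder) : Set where
  field
    to   : ∣ α ∣ → ∣ β ∣
    mono : ∀ {x y} → α [ x < y ] → β [ to x < to y ]

  injective : ∀ {x y} → to x ≡ to y → x ≡ y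
  injective {x} {y} eq with CountableOrder.compare α x y
  ... | tri< lt _ _ = ⊥-elim (CountableOrder.irrefl β eq (mono lt))
  ... | tri≈ _ x≡y _ = x≡y
  ... | tri> _ _ gt = ⊥-elim (CountableOrder.irrefl β (sym eq) (mono gt))

  cancel : ∀ {x y} → β [ to x < to y ] → α [ x < y ]
  cancel {x} {y} lt with CountableOrder.compare α x y
  ... | tri< x<y _ _ = x<y
  ... | tri≈ _ refl _ = ⊥-elim (CountableOrder.irrefl β refl lt)
  ... | tri> _ _ gt = ⊥-elim (CountableOrder.asym β lt (mono gt))

≃⇒↪ : ∀ {α β} → α ≃ β → α ↪ β
≃⇒↪ f = record { to = _≃_.to f ; mono = _≃_.mono f }

↪-trans : ∀ {α β γ} → α ↪ β → β ↪ γ → α ↪ γ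
↪-trans f g = record { to = _↪_.to g ∘ _↪_.to f ; mono = _↪_.mono g ∘ _↪_.mono f }

summand : ∀ {α} (β : ∣ α ∣ → CountableOrder) i → β i ↪ ∑ α β
summand β i = record { to = i ,_ ; mono = snd }

↾↪ : ∀ {α} (X : Subset α) → α ↾ X ↪ α
↾↪ X = record { to = value ; mono = id }

module _ (α : CountableOrder) where
  open CountableOrder α hiding (Carrier)

  -- The closed interval between x and y, whichever of them comes first: z is not strictly to one
  -- side of both.
  Hull : (x y z : ∣ α ∣) → Set
  Hull x y z = ¬ (z < x × z < y) × ¬ (x < z × y < z)

  -- The representatives `zs` may lie outside the interval. Being near of order 1 means that the
  -- interval is finite.
  Near : ℕ → ∣ α ∣ → ∣ α ∣ → Set
  Near zero    x y = x ≡ y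
  Near (suc n) x y = ∃[ zs ] ∀ z → Hull x y z → Any (Near n z) zs

  Small : ℕ → Set
  Small n = ∃[ zs ] ∀ z → Any (Near n z) zs

module _ {α : CountableOrder} where
  open CountableOrder α hiding (Carrier)

  hull-refl : ∀ {x z} → Hull α x x z → z ≡ x
  hull-refl {x} {z} (l , r) with compare z x
  ... | tri< lt _ _ = ⊥-elim (l (lt , lt))
  ... | tri≈ _ eq _ = eq
  ... | tri> _ _ gt = ⊥-elim (r (gt , gt))

  hull-sym : ∀ {x y z} → Hull α x y z → Hull α y x z
  hull-sym (l , r) = (λ (p , q) → l (q , p)) , (λ (p , q) → r (q , p))

  hull-start : ∀ {x y} → Hull α x y x
  hull-start = (λ (p , _) → irrefl refl p) , (λ (p , _) → irrefl refl p)

  hull-split : ∀ {x y z} u → Hull α x z u → Hull α x y u ⊎ Hull α y z u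
  hull-split {x} {y} {z} u (l , r) with compare u y
  ... | tri≈ _ refl _ = inj₂ hull-start
  ... | tri< u<y _ _ with u <? x
  ...   | yes u<x = inj₂ ((λ (_ , u<z) → l (u<x , u<z)) , λ (y<u , _) → asym u<y y<u)
  ...   | no u≮x  = inj₁ ((λ (u<x , _) → u≮x u<x) , λ (_ , y<u) → asym u<y y<u)
  hull-split {x} {y} {z} u (l , r) | tri> _ _ y<u with x <? u
  ...   | yes x<u = inj₂ ((λ (u<y , _) → asym u<y y<u) , λ (_ , z<u) → r (x<u , z<u))
  ...   | no x≮u  = inj₁ ((λ (_ , u<y) → asym u<y y<u) , λ (x<u , _) → x≮u x<u)

  <-of : ∀ {x y u} → u < x → ¬ u < y → y < x
  <-of {x} {y} {u} u<x u≮y with compare u y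
  ... | tri< u<y _ _  = ⊥-elim (u≮y u<y)
  ... | tri≈ _ refl _ = u<x
  ... | tri> _ _ y<u  = <-trans y<u u<x

  >-of : ∀ {x y u} → x < u → ¬ y < u → x < y
  >-of {x} {y} {u} x<u y≮u with compare y u
  ... | tri< y<u _ _  = ⊥-elim (y≮u y<u)
  ... | tri≈ _ refl _ = x<u
  ... | tri> _ _ u<y  = <-trans x<u u<y

  hull-⊆ : ∀ {x y z u} → Hull α x z y → Hull α x y u → Hull α x z u
  hull-⊆ (l , r) (l′ , r′) =
    (λ (u<x , u<z) → let u≮y = λ u<y → l′ (u<x , u<y) in l (<-of u<x u≮y , <-of u<z u≮y)) ,
    (λ (x<u , z<u) → let y≮u = λ y<u → r′ (x<u , y<u) in r (>-of x<u y≮u , >-of z<u y≮u))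

  near-refl : ∀ n {x} → Near α n x x
  near-refl zero    = refl
  near-refl (suc n) {x} = x ∷ [] , λ z h →
    here (subst (λ v → Near α n v x) (sym (hull-refl h)) (near-refl n))

  near-sym : ∀ n {x y} → Near α n x y → Near α n y x
  near-sym zero    eq       = sym eq
  near-sym (suc n) (zs , f) = zs , λ z h → f z (hull-sym h)

  near-trans : ∀ n {x y z} → Near α n x y → Near α n y z → Near α n x z
  near-trans zero    eq eq′ = trans eq eq′
  near-trans (suc n) (us , f) (vs , g) = us ++ vs , λ w h → case hull-split w h of λ
    { (inj₁ h′) → Any.++⁺ˡ (f w h′)
    ; (inj₂ h′) → Any.++⁺ʳ us (g w h′)
    }

  near-convex : ∀ n {x y z} → Hull α x z y → Near α n x z → Near α n x y
  near-convex zero    h refl     = sym (hull-refl h)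
  near-convex (suc n) h (zs , f) = zs , λ u h′ → f u (hull-⊆ h h′)

  -- By convexity a single class of order n contains the whole interval.
  near-suc : ∀ n {x y} → Near α n x y → Near α (suc n) x y
  near-suc n {x} p = x ∷ [] , λ z h → here (near-sym n (near-convex n h p))

  small-suc : ∀ n → Small α n → Small α (suc n)
  small-suc n (zs , f) = zs , λ z → Any.map (near-suc n) (f z)

  small-≤ : ∀ {m n} → m ℕ.≤′ n → Small α m → Small α n
  small-≤ (ℕ.≤′-reflexive refl) s = s
  small-≤ (ℕ.≤′-step m≤n)       s = small-suc _ (small-≤ m≤n s)

-- Summands are convex, so the interval between two points of a summand stays in it.
near-summand : ∀ {α} (β : ∣ α ∣ → CountableOrder) {i} n {x y} →
               Near (β i) n x y → Near (∑ α β) n (i , x) (i , y)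
near-summand β zero refl = refl
near-summand {α} β {i} (suc n) {x} {y} (zs , f) = map (i ,_) zs , cover
  where
  cover : ∀ z → Hull (∑ α β) (i , x) (i , y) z → Any (Near (∑ α β) n z) (map (i ,_) zs)
  cover (j , z) (l , r) with CountableOrder.compare α j i
  ... | tri< lt _ _   = ⊥-elim (l (fst lt , fst lt))
  ... | tri≈ _ refl _ = Any.map⁺ (Any.map (near-summand β n)
    (f z ((λ (p , q) → l (snd p , snd q)) , (λ (p , q) → r (snd p , snd q)))))
  ... | tri> _ _ gt   = ⊥-elim (r (fst gt , fst gt))

𝓘-nonempty : ∀ {n α} → 𝓘 n α → ∣ α ∣
𝓘-nonempty (finite a _)    = a
𝓘-nonempty (ℤ-sum a _ _ _) = a
𝓘-nonempty (+-sum a _ _ _ _) = a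

module Nearness (lem : (P : Set) → Dec P) where

  module _ {α β} (f : α ↪ β) where
    open _↪_ f

    near-reflect : ∀ n {x y} → Near β n (to x) (to y) → Near α n x y

    -- Each representative in β is replaced by some point of α near to it, if there is one. Excluded
    -- middle decides which case holds, and transitivity makes the new point a representative.
    cover-reflect : ∀ n vs → ∃[ us ] ∀ u → Any (Near β n (to u)) vs → Any (Near α n u) us
    cover-reflect n [] = [] , λ _ ()
    cover-reflect n (v ∷ vs) with lem (∃[ u ] Near β n (to u) v) | cover-reflect n vs
    ... | yes (u₀ , p₀) | us , k = u₀ ∷ us , λ u → λ
      { (here p)  → here (near-reflect n (near-trans n p (near-sym n p₀)))
      ; (there q) → there (k u q)
      }
    ... | no ∄u | us , k = us , λ u → λ
      { (here p)  → ⊥-elim (∄u (u , p))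
      ; (there q) → k u q
      }

    near-reflect zero    eq = injective eq
    near-reflect (suc n) {x} {y} (vs , g) =
      let us , k = cover-reflect n vs in us , λ u (l , r) → k u (g (to u)
        ((λ (p , q) → l (cancel p , cancel q)) , (λ (p , q) → r (cancel p , cancel q))))

    small-reflect : ∀ n → Small β n → Small α n
    small-reflect n (vs , g) = let us , k = cover-reflect n vs in us , λ u → k u (g (to u))

  hull-bounded : ∀ i j {k} → Hull ℤ-order i j k → ℤ.∣ k ∣ ℕ.≤ ℤ.∣ i ∣ ℕ.⊔ ℤ.∣ j ∣
  hull-bounded i j {k} (l , r) = go k l r
    where
    above : ∀ {i m} → ¬ i ℤ.< + m → m ℕ.≤ ℤ.∣ i ∣
    above i≮m with ℤ.≮⇒≥ i≮m
    ... | ℤ.+≤+ m≤n = m≤n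

    below : ∀ {i m} → ¬ -[1+ m ] ℤ.< i → suc m ℕ.≤ ℤ.∣ i ∣
    below m≮i with ℤ.≮⇒≥ m≮i
    ... | ℤ.-≤- m≤n = s≤s m≤n

    go : ∀ k → ¬ (k ℤ.< i × k ℤ.< j) → ¬ (i ℤ.< k × j ℤ.< k) → ℤ.∣ k ∣ ℕ.≤ ℤ.∣ i ∣ ℕ.⊔ ℤ.∣ j ∣
    go (+ m) _ r with i ℤ.<? + m
    ... | yes i<m = ℕ.m≤n⇒m≤o⊔n ℤ.∣ i ∣ (above {j} λ j<m → r (i<m , j<m))
    ... | no i≮m  = ℕ.m≤n⇒m≤n⊔o ℤ.∣ j ∣ (above {i} i≮m)
    go -[1+ m ] l _ with -[1+ m ] ℤ.<? i
    ... | yes m<i = ℕ.m≤n⇒m≤o⊔n ℤ.∣ i ∣ (below {j} λ m<j → l (m<i , m<j))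
    ... | no m≮i  = ℕ.m≤n⇒m≤n⊔o ℤ.∣ j ∣ (below {i} m≮i)

  module _ {n} (β : ℤ → CountableOrder) (small : ∀ k → Small (β k) n) where

    private
      σ : CountableOrder
      σ = ∑ ℤ-order β

      layer : ℤ → List ∣ σ ∣
      layer k = map (k ,_) (proj₁ (small k))

      layers : ℕ → List ∣ σ ∣
      layers zero    = layer (+ 0)
      layers (suc b) = layer (+ suc b) ++ layer -[1+ b ] ++ layers b

    layer-covers : ∀ k u → Any (Near σ n (k , u)) (layer k)
    layer-covers k u = Any.map⁺ (Any.map (near-summand β n) (proj₂ (small k) u))

    layers-cover : ∀ {b} k u → ℤ.∣ k ∣ ℕ.≤′ b → Any (Near σ n (k , u)) (layers b)
    layers-cover (+ zero)  u (ℕ.≤′-reflexive refl) = layer-covers (+ 0) u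
    layers-cover (+ suc m) u (ℕ.≤′-reflexive refl) = Any.++⁺ˡ (layer-covers (+ suc m) u)
    layers-cover -[1+ m ]  u (ℕ.≤′-reflexive refl) =
      Any.++⁺ʳ (layer (+ suc m)) (Any.++⁺ˡ (layer-covers -[1+ m ] u))
    layers-cover k u (ℕ.≤′-step {b} le) =
      Any.++⁺ʳ (layer (+ suc b)) (Any.++⁺ʳ (layer -[1+ b ]) (layers-cover k u le))

    -- Only finitely many summands meet the interval between two points, and each contributes
    -- finitely many classes of order n.
    ℤ-sum-near : ∀ p q → Near σ (suc n) p q
    ℤ-sum-near (i , x) (j , y) = layers (ℤ.∣ i ∣ ℕ.⊔ ℤ.∣ j ∣) , λ (k , z) (l , r) →
      layers-cover k z (ℕ.≤⇒≤′ (hull-bounded i j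
        ((λ (p , q) → l (fst p , fst q)) , (λ (p , q) → r (fst p , fst q)))))

  -- A ℤ-sum is a single class of the next order, and a finite sum collects the representatives of
  -- its summands.
  𝓘⇒small : ∀ {n α} → 𝓘 n α → Small α n
  𝓘⇒small (finite _ (m , inv)) = tabulate I.from , λ z →
    Any.tabulate⁺ (I.to z) (sym (I.strictlyInverseʳ z))
    where module I = Inverse inv
  𝓘⇒small {suc n} (ℤ-sum a β ih f) = small-reflect (≃⇒↪ f) (suc n)
    (_≃_.to f a ∷ [] , λ z → here (ℤ-sum-near β small z (_≃_.to f a)))
    where
    small : ∀ k → Small (β k) n
    small k with ih k
    ... | inj₁ r = 𝓘⇒small r
    ... | inj₂ ∅ = [] , λ z → ⊥-elim (∅ z)
  𝓘⇒small {suc n} (+-sum a k β ih f) = small-reflect (≃⇒↪ f) (suc n)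
    (concat (tabulate λ i → map (i ,_) (proj₁ (𝓘⇒small (ih i)))) , λ (i , z) →
      Any.concat⁺ (Any.tabulate⁺ i
        (Any.map⁺ (Any.map (near-summand β (suc n)) (proj₂ (𝓘⇒small (ih i)) z)))))

  module _ {α : CountableOrder} (a : ∣ α ∣) where

    private
      σ : CountableOrder
      σ = ∑ Ω (const α)

    -- Copy 2k + 1 lies between the copies 2k and 2l.
    copies-apart : ∀ n → ¬ Small α n → ∀ {k l} → k ℕ.< l →
                   ¬ Near σ (suc n) (lo (2 ℕ.* k) , a) (lo (2 ℕ.* l) , a)
    copies-apart n ¬small {k} {l} k<l (vs , g) =
      ¬small (let us , h = cover-reflect (summand (const α) (lo (suc (2 ℕ.* k)))) n vs in
              us , λ u → h u (g _ (between u)))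
      where
      2k+1<2l : suc (2 ℕ.* k) ℕ.< 2 ℕ.* l
      2k+1<2l = subst (ℕ._≤ 2 ℕ.* l) (ℕ.*-suc 2 k) (ℕ.*-monoʳ-≤ 2 k<l)

      between : ∀ u → Hull σ (lo (2 ℕ.* k) , a) (lo (2 ℕ.* l) , a) (lo (suc (2 ℕ.* k)) , u)
      between u = (λ (p , _) → CountableOrder.asym σ p (fst (snd ℕ.≤-refl))) ,
                  (λ (_ , q) → CountableOrder.asym σ q (fst (snd 2k+1<2l)))

    copies-apart₀ : ∀ {k l} → k ℕ.< l → ¬ Near σ 0 (lo (2 ℕ.* k) , a) (lo (2 ℕ.* l) , a)
    copies-apart₀ {k} {l} k<l eq =
      ℕ.<⇒≢ (ℕ.*-monoʳ-< 2 k<l) (lo-injective (cong proj₁ eq))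
      where
      lo-injective : ∀ {k l} → _≡_ {A = ∣ Ω ∣} (lo k) (lo l) → k ≡ l
      lo-injective refl = refl

  apart⇒¬small : ∀ {α} n (x : ℕ → ∣ α ∣) → (∀ {k l} → k ℕ.< l → ¬ Near α n (x k) (x l)) →
                 ¬ Small α n
  apart⇒¬small {α} n x apart (zs , f)
    with Fin.pigeonhole (ℕ.n<1+n (length zs)) (λ i → Any.index (f (x (toℕ i))))
  ... | i , j , i<j , eq = apart i<j (near-trans n (Any.lookup-index (f (x (toℕ i))))
    (subst (λ k → Near α n (lookup zs k) (x (toℕ j))) (sym eq)
      (near-sym n (Any.lookup-index (f (x (toℕ j)))))))

  ∑Ω-¬small₀ : ∀ {α} → ∣ α ∣ → ¬ Small (∑ Ω (const α)) 0
  ∑Ω-¬small₀ {α} a =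
    apart⇒¬small {∑ Ω (const α)} 0 (λ k → lo (2 ℕ.* k) , a) (copies-apart₀ {α} a)

  ∑Ω-¬small : ∀ {α n} → ∣ α ∣ → ¬ Small α n → ¬ Small (∑ Ω (const α)) (suc n)
  ∑Ω-¬small {α} {n} a ¬small =
    apart⇒¬small {∑ Ω (const α)} (suc n) (λ k → lo (2 ℕ.* k) , a) (copies-apart {α} a n ¬small)

-- Suborders and the infinitary rank

enumerated⇒finite : {A : Set} → DecidableEquality A → (xs : List A) → (∀ x → x ∈ xs) →
                    Finite (≡.setoid A)
enumerated⇒finite {A} _≟_ xs complete = length ys , mk↔ₛ′
  (λ x → Any.index (∈ys x)) (lookup ys)
  (λ i → sym (lookup-injective unique (Any.lookup-index (∈ys (lookup ys i)))))
  (λ x → sym (Any.lookup-index (∈ys x)))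
  where
  ys : List A
  ys = deduplicate _≟_ xs

  unique : Unique ys
  unique = deduplicate-! _≟_ xs

  ∈ys : ∀ x → x ∈ ys
  ∈ys x = Membership.∈-deduplicate⁺ _≟_ (complete x)

  lookup-injective : ∀ {zs : List A} → Unique zs → ∀ {i j} → lookup zs i ≡ lookup zs j → i ≡ j
  lookup-injective (_ ∷ _)  {zero}  {zero}  eq = refl
  lookup-injective (p ∷ _)  {zero}  {suc j} eq =
    ⊥-elim (All.lookup p (Membership.∈-lookup j) eq)
  lookup-injective (p ∷ _)  {suc i} {zero}  eq =
    ⊥-elim (All.lookup p (Membership.∈-lookup i) (sym eq))
  lookup-injective (_ ∷ ps) {suc i} {suc j} eq = cong suc (lookup-injective ps eq)

module _ {α γ : CountableOrder} {β : ∣ α ∣ → CountableOrder} (g : γ ↪ ∑ α β) where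
  private
    module α = CountableOrder α
    module g = _↪_ g
    _≟_ = IsStrictTotalOrder._≟_ α.isStrictTotalOrder

  fibre : ∣ α ∣ → CountableOrder
  fibre i = γ ↾ λ c → proj₁ (g.to c) ≡ i

  fibre-↪ : ∀ i → fibre i ↪ β i
  fibre-↪ i = record
    { to   = λ { (c , [ p ]) → subst (∣_∣ ∘ β) (recompute (_ ≟ i) p) (proj₂ (g.to c)) }
    ; mono = λ lt → subst-mono _ _ (g.mono lt)
    }
    where
    subst-mono : ∀ {p q} (eq : proj₁ p ≡ i) (eq′ : proj₁ q ≡ i) → ∑ α β [ p < q ] →
      β i [ subst (∣_∣ ∘ β) eq (proj₂ p) < subst (∣_∣ ∘ β) eq′ (proj₂ q) ]
    subst-mono refl refl (fst lt) = ⊥-elim (α.irrefl refl lt)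
    subst-mono refl refl (snd lt) = lt

  -- The index order κ has to contain only the indices that γ meets. It is all of ℤ for ℤ-sums and
  -- the set of indices with nonempty fibre for finite sums.
  fibres : ∀ {κ} (j : κ ↪ α) → (∀ c → ∃[ k ] _↪_.to j k ≡ proj₁ (g.to c)) →
           γ ≃ ∑ κ (fibre ∘ _↪_.to j)
  fibres {κ} j cover = ≃-sym (mk≃ (λ (_ , c) → value c) mono surj)
    where
    module j = _↪_ j
    mono : ∀ {p q} → ∑ κ (fibre ∘ j.to) [ p < q ] → γ [ value (proj₂ p) < value (proj₂ q) ]
    mono {k , (c , [ p ])} {l , (d , [ q ])} (fst lt) = g.cancel (fst (≡.subst₂ α._<_
      (sym (recompute (_ ≟ j.to k) p)) (sym (recompute (_ ≟ j.to l) q)) (j.mono lt)))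
    mono (snd lt) = lt

    surj : StrictlySurjective _≡_ λ (_ , c) → value c
    surj c with cover c
    ... | k , eq = (k , (c , [ sym eq ])) , refl

module Suborders (lem : (P : Set) → Dec P) where
  open Nearness lem

  -- The summands of `+-sum` must be nonempty, so a suborder of a finite sum has to be indexed by
  -- its nonempty fibres.
  filter-Fin : ∀ k (P : Fin k → Set) → ∃[ m ] Σ (ordinal m ↪ ordinal k) λ j →
               (∀ i → P (_↪_.to j i)) × (∀ i → P i → ∃[ i′ ] _↪_.to j i′ ≡ i)
  filter-Fin zero P = 0 , record { to = id ; mono = id } , (λ ()) , λ ()
  filter-Fin (suc k) P with lem (P zero) | filter-Fin k (P ∘ suc)
  ... | no ¬p₀ | m , j , sound , complete =
    m , record { to = suc ∘ j.to ; mono = s≤s ∘ j.mono } , sound , λ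
      { zero    p → ⊥-elim (¬p₀ p)
      ; (suc i) p → let i′ , eq = complete i p in i′ , cong suc eq
      }
    where module j = _↪_ j
  ... | yes p₀ | m , j , sound , complete =
    suc m , record { to = to ; mono = mono } , (λ { zero → p₀ ; (suc i) → sound i }) , λ
      { zero    p → zero , refl
      ; (suc i) p → let i′ , eq = complete i p in suc i′ , cong suc eq
      }
    where
    module j = _↪_ j
    to : Fin (suc m) → Fin (suc k)
    to zero    = zero
    to (suc i) = suc (j.to i)

    mono : ∀ {x y} → x Fin.< y → to x Fin.< to y
    mono {zero}  {suc y} _        = z<s
    mono {suc x} {suc y} (s≤s lt) = s≤s (j.mono lt)

  𝓘-sub : ∀ {n α γ} → 𝓘 n α → γ ↪ α → ∣ γ ∣ → 𝓘 n γ
  𝓘-sub {γ = γ} r@(finite _ _) g c =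
    -- Nearness of order 0 is equality, so smallness of order 0 is a list of all points.
    let cs , complete = small-reflect g 0 (𝓘⇒small r) in
    finite c (enumerated⇒finite (IsStrictTotalOrder._≟_ (CountableOrder.isStrictTotalOrder γ))
                                cs complete)
  𝓘-sub {suc n} {γ = γ} (ℤ-sum _ β ih f) g c =
    ℤ-sum c (fibre g′) sub (fibres g′ (record { to = id ; mono = id }) λ c → _ , refl)
    where
    g′ : γ ↪ ∑ ℤ-order β
    g′ = ↪-trans g (≃⇒↪ f)

    sub : ∀ i → 𝓘 n (fibre g′ i) ⊎ ¬ ∣ fibre g′ i ∣
    sub i with lem ∣ fibre g′ i ∣
    ... | no ∅  = inj₂ ∅
    ... | yes x with ih i
    ...   | inj₁ r = inj₁ (𝓘-sub r (fibre-↪ g′ i) x)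
    ...   | inj₂ ∅ = ⊥-elim (∅ (_↪_.to (fibre-↪ g′ i) x))
  𝓘-sub {γ = γ} (+-sum {n} _ k β ih f) g c
    with filter-Fin k (∣_∣ ∘ fibre (↪-trans g (≃⇒↪ f)))
  ... | m , j , sound , complete = +-sum c m (fibre g′ ∘ _↪_.to j)
    (λ i → 𝓘-sub (ih (_↪_.to j i)) (fibre-↪ g′ _) (sound i))
    (fibres g′ j λ c → complete _ (c , [ refl ]))
    where
    g′ : γ ↪ ∑ (ordinal k) β
    g′ = ↪-trans g (≃⇒↪ f)

  𝓘-⊕ : ∀ {n α} (β : Fin 2 → CountableOrder) → (∀ i → 𝓘 (suc n) (β i)) →
         α ≃ ∑ (ordinal 2) β → 𝓘 (suc n) α
  𝓘-⊕ β r f = +-sum (_≃_.to (≃-sym f) (zero , 𝓘-nonempty (r zero))) 2 β r f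

  -- The sums over ω and over ω* are ℤ-sums with empty summands on the other half of ℤ, and the sum
  -- over `Ω` is their finite sum.
  𝓘-Ω : ∀ {n α} → 𝓘 n α → 𝓘 (suc n) (∑ Ω (const α))
  𝓘-Ω {n} {α} r = 𝓘-⊕ half 𝓘-half (mk≃ to mono surj)
    where
    a : ∣ α ∣
    a = 𝓘-nonempty r

    half : Fin 2 → CountableOrder
    half i = ∑ (lookup (ω ∷ ω* ∷ []) i) (const α)

    to : ∣ ∑ Ω (const α) ∣ → ∣ ∑ (ordinal 2) half ∣
    to ((i , k) , x) = i , (k , x)

    mono : ∀ {p q} → ∑ Ω (const α) [ p < q ] → ∑ (ordinal 2) half [ to p < to q ]
    mono (fst (fst lt)) = fst lt
    mono (fst (snd lt)) = snd (fst lt)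
    mono (snd lt)       = snd (snd lt)

    surj : StrictlySurjective _≡_ to
    surj (i , (k , x)) = ((i , k) , x) , refl

    empty : CountableOrder
    empty = ordinal 0

    γ δ : ℤ → CountableOrder
    γ (+ _)    = α
    γ -[1+ _ ] = empty
    δ (+ _)    = empty
    δ -[1+ _ ] = α

    𝓘-half : ∀ i → 𝓘 (suc n) (half i)
    𝓘-half zero = ℤ-sum (0 , a) γ
      (λ { (+ _) → inj₁ r ; -[1+ _ ] → inj₂ λ () })
      (mk≃ {β = ∑ ℤ-order γ} (λ (k , x) → + k , x)
        (λ { (fst lt) → fst (ℤ.+<+ lt) ; (snd lt) → snd lt })
        λ { (+ k , x) → (k , x) , refl })
    𝓘-half (suc zero) = ℤ-sum (0 , a) δ
      (λ { (+ _) → inj₂ λ () ; -[1+ _ ] → inj₁ r })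
      (mk≃ {β = ∑ ℤ-order δ} (λ (k , x) → -[1+ k ] , x)
        (λ { (fst lt) → fst (ℤ.-<- lt) ; (snd lt) → snd lt })
        λ { (-[1+ k ] , x) → (k , x) , refl })

-- Aperiodicity

∃-⇔ : ∀ {a p q} {A : Set a} {P : A → Set p} {Q : A → Set q} →
      (∀ x → P x ⇔ Q x) → ∃ P ⇔ ∃ Q
∃-⇔ e = mk⇔ (λ (x , p) → x , Equivalence.to (e x) p) (λ (x , q) → x , Equivalence.from (e x) q)

∀-⇔ : ∀ {a p q} {A : Set a} {P : A → Set p} {Q : A → Set q} →
      (∀ x → P x ⇔ Q x) → (∀ x → P x) ⇔ (∀ x → Q x)
∀-⇔ e = mk⇔ (λ f x → Equivalence.to (e x) (f x)) (λ f x → Equivalence.from (e x) (f x))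

Lift-⇔ : ∀ {a b} {A : Set a} → Lift b A ⇔ A
Lift-⇔ = mk⇔ lower lift

-- An Ehrenfeucht–Fraïssé argument for the orders N and N + 1: the points of
-- the second are those of the first, shifted by one beyond a gap of length d
-- that contains no point.
Shift : ℕ → ℕ → ℕ → ℕ → Set
Shift g d a b = (a ℕ.≤ g × b ≡ a) ⊎ (g ℕ.+ d ℕ.≤ a × b ≡ suc a)

module _ {g d : ℕ} where

  shift-mono : ∀ {a a′ b b′} → 1 ℕ.≤ d → Shift g d a b → Shift g d a′ b′ → a ℕ.< a′ → b ℕ.< b′
  shift-mono 1≤d (inj₁ (_ , refl)) (inj₁ (_ , refl)) lt = lt
  shift-mono 1≤d (inj₁ (_ , refl)) (inj₂ (_ , refl)) lt = ℕ.m<n⇒m<1+n lt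
  shift-mono 1≤d (inj₂ (q , refl)) (inj₁ (p , refl)) lt =
    ⊥-elim (ℕ.<⇒≱ lt (ℕ.≤-trans p (ℕ.≤-trans (ℕ.m≤m+n g d) q)))
  shift-mono 1≤d (inj₂ (_ , refl)) (inj₂ (_ , refl)) lt = s≤s lt

  shift-cancel : ∀ {a a′ b b′} → 1 ℕ.≤ d → Shift g d a b → Shift g d a′ b′ → b ℕ.< b′ → a ℕ.< a′
  shift-cancel 1≤d (inj₁ (_ , refl)) (inj₁ (_ , refl)) lt = lt
  shift-cancel 1≤d (inj₁ (p , refl)) (inj₂ (q , refl)) lt =
    ℕ.≤-trans (s≤s p) (ℕ.≤-trans (ℕ.m<m+n g 1≤d) q)
  shift-cancel 1≤d (inj₂ (q , refl)) (inj₁ (p , refl)) lt =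
    ⊥-elim (ℕ.<⇒≱ lt (ℕ.≤-trans p (ℕ.≤-trans (ℕ.m≤m+n g d) (ℕ.m≤n⇒m≤1+n q))))
  shift-cancel 1≤d (inj₂ (_ , refl)) (inj₂ (_ , refl)) (s≤s lt) = lt

infix 4 _⊒_
-- The gap of length e at g′ lies inside the gap of length d at g.
_⊒_ : ℕ × ℕ → ℕ × ℕ → Set
(g , d) ⊒ (g′ , e) = g ℕ.≤ g′ × g′ ℕ.+ e ℕ.≤ g ℕ.+ d

shift-narrow : ∀ {g d g′ e a b} → (g , d) ⊒ (g′ , e) → Shift g d a b → Shift g′ e a b
shift-narrow (p , q) (inj₁ (r , eq)) = inj₁ (ℕ.≤-trans r p , eq)
shift-narrow (p , q) (inj₂ (r , eq)) = inj₂ (ℕ.≤-trans q r , eq)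

module _ (g e : ℕ) where

  left-half : ∀ {p} → p ℕ.≤ g ℕ.+ e → (g , e ℕ.+ e) ⊒ (g ℕ.⊔ p , e)
  left-half {p} p≤g+e = ℕ.m≤m⊔n g p , (begin
    g ℕ.⊔ p ℕ.+ e     ≤⟨ ℕ.+-monoˡ-≤ e (ℕ.⊔-lub (ℕ.m≤m+n g e) p≤g+e) ⟩
    g ℕ.+ e ℕ.+ e     ≡⟨ ℕ.+-assoc g e e ⟩
    g ℕ.+ (e ℕ.+ e)   ∎)
    where open ℕ.≤-Reasoning

  right-half : (g , e ℕ.+ e) ⊒ (g , e)
  right-half = ℕ.≤-refl , ℕ.+-monoʳ-≤ g (ℕ.m≤m+n e e)

  -- A point up to the middle of the gap is kept and the gap restarts behind it; a later point is
  -- shifted. Either way a gap of half the length remains.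
  forth : ∀ p → ∃[ g′ ] ∃[ q ] ((g , e ℕ.+ e) ⊒ (g′ , e)) × Shift g′ e p q × q ℕ.≤ suc p
  forth p with p ℕ.≤? g ℕ.+ e
  ... | yes p≤ = g ℕ.⊔ p , p , left-half p≤ , inj₁ (ℕ.m≤n⊔m g p , refl) , ℕ.n≤1+n p
  ... | no p≰  = g , suc p , right-half , inj₂ (ℕ.≰⇒≥ p≰ , refl) , ℕ.≤-refl

  -- The last component keeps the answer inside the shorter order: if q is p + 1, the bound on p
  -- follows from the one on q.
  back : ∀ q {N} → 1 ℕ.≤ e → g ℕ.+ (e ℕ.+ e) ℕ.≤ N →
         ∃[ g′ ] ∃[ p ] ((g , e ℕ.+ e) ⊒ (g′ , e)) × Shift g′ e p q × (p ℕ.< N ⊎ q ≡ suc p)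
  back q {N} 1≤e g+2e≤N with q ℕ.≤? g ℕ.+ e
  ... | yes q≤ = g ℕ.⊔ q , q , left-half q≤ , inj₁ (ℕ.m≤n⊔m g q , refl) , inj₁ (begin-strict
    q               ≤⟨ q≤ ⟩
    g ℕ.+ e         <⟨ ℕ.+-monoʳ-< g (ℕ.m<m+n e 1≤e) ⟩
    g ℕ.+ (e ℕ.+ e) ≤⟨ g+2e≤N ⟩
    N               ∎)
    where open ℕ.≤-Reasoning
  back zero    _ _ | no q≰ = ⊥-elim (q≰ ℕ.z≤n)
  back (suc p) _ _ | no q≰ = g , p , right-half , inj₂ (ℕ.s≤s⁻¹ (ℕ.≰⇒> q≰) , refl) , inj₂ refl

module FiniteWords (lem : (P : Set) → Dec P) {A : Setoid 0ℓ 0ℓ} (a : Setoid.Carrier A) where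
  open Suborders lem
  private module A = Setoid A

  constant : ℕ → Word A
  constant N = word (ordinal N) (const a)

  Aligned : ∀ {N n} → ℕ → ℕ → Vec (Fin N) n → Vec (Fin (suc N)) n → Set
  Aligned g d = Pointwise λ x x′ → Shift g d (toℕ x) (toℕ x′)

  -- Representing a cut by a number lets it be played in the game like a point.
  IsCut : ∀ {N} → Subset (ordinal N) → ℕ → Set
  IsCut X c = ∀ x → X x ⇔ toℕ x ℕ.< c

  Aligned-cuts : ∀ {N k} → ℕ → ℕ → Vec (Subset (ordinal N)) k →
                 Vec (Subset (ordinal (suc N))) k → Set₁
  Aligned-cuts g d = Pointwise λ X X′ →
    ∃[ c ] ∃[ c′ ] IsCut X c × IsCut X′ c′ × Shift g d c c′

  aligned-narrow : ∀ {N n g d g′ e} {s : Vec (Fin N) n} {s′} → (g , d) ⊒ (g′ , e) →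
                   Aligned g d s s′ → Aligned g′ e s s′
  aligned-narrow h = Pointwise.map (shift-narrow h)

  cuts-narrow : ∀ {N k g d g′ e} {S : Vec (Subset (ordinal N)) k} {S′} → (g , d) ⊒ (g′ , e) →
                Aligned-cuts g d S S′ → Aligned-cuts g′ e S S′
  cuts-narrow h = Pointwise.map λ (c , c′ , p , p′ , sh) → c , c′ , p , p′ , shift-narrow h sh

  find-cut : ∀ {N} (X : Subset (ordinal N)) → LeftClosed (ordinal N) X →
             ∃[ c ] c ℕ.≤ N × IsCut X c
  find-cut {zero}  X closed = 0 , ℕ.z≤n , λ ()
  find-cut {suc N} X closed with lem (X zero)
  ... | no ¬X₀ = 0 , ℕ.z≤n , λ
    { zero    → mk⇔ (λ x → ⊥-elim (¬X₀ x)) λ ()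
    ; (suc i) → mk⇔ (λ x → ⊥-elim (¬X₀ (closed {zero} {suc i} z<s x))) λ ()
    }
  ... | yes X₀ with find-cut (X ∘ suc) (λ lt → closed (s≤s lt))
  ...   | c , c≤N , isCut = suc c , s≤s c≤N , λ
    { zero    → mk⇔ (const z<s) (const X₀)
    ; (suc i) → mk⇔ (s≤s ∘ Equivalence.to (isCut i)) (Equivalence.from (isCut i) ∘ ℕ.s≤s⁻¹)
    }

  lower-set-closed : ∀ {N} c → LeftClosed (ordinal N) (λ x → toℕ x ℕ.< c)
  lower-set-closed c x<y y<c = ℕ.<-trans x<y y<c

  point : ∀ {N} q → q ℕ.< N → ∃[ x ] q ≡ toℕ {N} x
  point q q<N = fromℕ< q<N , sym (Fin.toℕ-fromℕ< q<N)

  module _ {N g e : ℕ} (1≤e : 1 ℕ.≤ e) (fits : g ℕ.+ (e ℕ.+ e) ℕ.≤ N) where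

    Extends : Fin N → Fin (suc N) → Set
    Extends x x′ = ∃[ g′ ] (g , e ℕ.+ e) ⊒ (g′ , e) × Shift g′ e (toℕ x) (toℕ x′)

    forth-point : ∀ x → ∃[ x′ ] Extends x x′
    forth-point x with forth g e (toℕ x)
    ... | g′ , q , h , sh , q≤ with point q (s≤s (ℕ.≤-trans q≤ (Fin.toℕ<n x)))
    ...   | x′ , refl = x′ , g′ , h , sh

    back-point : ∀ x′ → ∃[ x ] Extends x x′
    back-point x′ with back g e (toℕ x′) 1≤e fits
    ... | g′ , p , h , sh , bound with point p (p<N bound)
      where
      p<N : (p ℕ.< N ⊎ toℕ x′ ≡ suc p) → p ℕ.< N
      p<N (inj₁ lt) = lt
      p<N (inj₂ eq) = subst (ℕ._≤ N) eq (ℕ.s≤s⁻¹ (Fin.toℕ<n x′))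
    ...   | x , refl = x , g′ , h , sh

  fits-narrow : ∀ {g d g′ e N} → (g , d) ⊒ (g′ , e) → g ℕ.+ d ℕ.≤ N → g′ ℕ.+ e ℕ.≤ N
  fits-narrow (_ , q) fits = ℕ.≤-trans q fits

  ⊒-⊔ˡ : ∀ g d d′ → (g , d ℕ.⊔ d′) ⊒ (g , d)
  ⊒-⊔ˡ g d d′ = ℕ.≤-refl , ℕ.+-monoʳ-≤ g (ℕ.m≤m⊔n d d′)

  ⊒-⊔ʳ : ∀ g d d′ → (g , d ℕ.⊔ d′) ⊒ (g , d′)
  ⊒-⊔ʳ g d d′ = ℕ.≤-refl , ℕ.+-monoʳ-≤ g (ℕ.m≤n⊔m d d′)

  module _ where
    open FOSet

    -- Atoms require a gap of length 1, and each quantifier, over points or over cuts, halves the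
    -- gap.
    gap : ∀ {n k} → FOSet A.Carrier n k → ℕ
    gap (_ <ᶠ _)      = 1
    gap (letterᶠ _ _) = 1
    gap (_ ∈ᶠ _)      = 1
    gap (¬ᶠ φ)        = gap φ
    gap (φ ∧ᶠ ψ)      = gap φ ℕ.⊔ gap ψ
    gap (φ ∨ᶠ ψ)      = gap φ ℕ.⊔ gap ψ
    gap (∃ᶠ φ)        = gap φ ℕ.+ gap φ
    gap (∃ˢ φ)        = gap φ ℕ.+ gap φ

    1≤gap : ∀ {n k} (φ : FOSet A.Carrier n k) → 1 ℕ.≤ gap φ
    1≤gap (_ <ᶠ _)      = ℕ.≤-refl
    1≤gap (letterᶠ _ _) = ℕ.≤-refl
    1≤gap (_ ∈ᶠ _)      = ℕ.≤-refl
    1≤gap (¬ᶠ φ)        = 1≤gap φ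
    1≤gap (φ ∧ᶠ ψ)      = ℕ.m≤n⇒m≤n⊔o (gap ψ) (1≤gap φ)
    1≤gap (φ ∨ᶠ ψ)      = ℕ.m≤n⇒m≤n⊔o (gap ψ) (1≤gap φ)
    1≤gap (∃ᶠ φ)        = ℕ.m≤n⇒m≤n+o (gap φ) (1≤gap φ)
    1≤gap (∃ˢ φ)        = ℕ.m≤n⇒m≤n+o (gap φ) (1≤gap φ)

    module _ {N : ℕ} where
      private
        ⊨  = ⟦_⟧ˢ (constant N) LeftClosed
        ⊨′ = ⟦_⟧ˢ (constant (suc N)) LeftClosed

      preserve : ∀ {n k} (φ : FOSet A.Carrier n k) {g s s′ S S′} → g ℕ.+ gap φ ℕ.≤ N →
        Aligned g (gap φ) s s′ → Aligned-cuts g (gap φ) S S′ → ⊨ φ s S ⇔ ⊨′ φ s′ S′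
      preserve-⊒ : ∀ {n k} (φ : FOSet A.Carrier n k) {g d g′ s s′ S S′} → (g , d) ⊒ (g′ , gap φ) →
        g ℕ.+ d ℕ.≤ N → Aligned g d s s′ → Aligned-cuts g d S S′ → ⊨ φ s S ⇔ ⊨′ φ s′ S′
      preserve-⊒ φ h fits al alc =
        preserve φ (fits-narrow h fits) (aligned-narrow h al) (cuts-narrow h alc)

      preserve (x <ᶠ y) fits al alc = mk⇔
        (λ (lift lt) → lift
          (shift-mono ℕ.≤-refl (Pointwise.lookup al x) (Pointwise.lookup al y) lt))
        (λ (lift lt) → lift
          (shift-cancel ℕ.≤-refl (Pointwise.lookup al x) (Pointwise.lookup al y) lt))
      preserve (letterᶠ _ _) fits al alc = mk⇔ id id
      preserve (x ∈ᶠ X) fits al alc = let _ , _ , p , p′ , sh = Pointwise.lookup alc X in mk⇔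
        (λ (lift i) → lift (Equivalence.from (p′ _)
          (shift-mono ℕ.≤-refl (Pointwise.lookup al x) sh (Equivalence.to (p _) i))))
        (λ (lift i) → lift (Equivalence.from (p _)
          (shift-cancel ℕ.≤-refl (Pointwise.lookup al x) sh (Equivalence.to (p′ _) i))))
      preserve (¬ᶠ φ) fits al alc = ¬-cong-⇔ (preserve φ fits al alc)
      preserve (φ ∧ᶠ ψ) {g} fits al alc =
        preserve-⊒ φ (⊒-⊔ˡ g (gap φ) (gap ψ)) fits al alc ×-⇔
        preserve-⊒ ψ (⊒-⊔ʳ g (gap φ) (gap ψ)) fits al alc
      preserve (φ ∨ᶠ ψ) {g} fits al alc =
        preserve-⊒ φ (⊒-⊔ˡ g (gap φ) (gap ψ)) fits al alc ⊎-⇔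
        preserve-⊒ ψ (⊒-⊔ʳ g (gap φ) (gap ψ)) fits al alc
      preserve (∃ᶠ φ) fits al alc = mk⇔
        (λ (x , p) → let x′ , _ , h , sh = forth-point (1≤gap φ) fits x in
          x′ , Equivalence.to (preserve φ (fits-narrow h fits)
            (sh ∷ aligned-narrow h al) (cuts-narrow h alc)) p)
        (λ (x′ , p) → let x , _ , h , sh = back-point (1≤gap φ) fits x′ in
          x , Equivalence.from (preserve φ (fits-narrow h fits)
            (sh ∷ aligned-narrow h al) (cuts-narrow h alc)) p)
      preserve (∃ˢ φ) {g} fits al alc = mk⇔ to from
        where
        to : ⊨ (∃ˢ φ) _ _ → ⊨′ (∃ˢ φ) _ _
        to (X , closed , p) with find-cut X closed
        ... | c , _ , isCut with forth g (gap φ) c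
        ...   | g′ , c′ , h , sh , _ = (λ x → toℕ x ℕ.< c′) , lower-set-closed c′ ,
          Equivalence.to (preserve φ (fits-narrow h fits) (aligned-narrow h al)
            ((c , c′ , isCut , (λ _ → mk⇔ id id) , sh) ∷ cuts-narrow h alc)) p

        from : ⊨′ (∃ˢ φ) _ _ → ⊨ (∃ˢ φ) _ _
        from (X , closed , p) with find-cut X closed
        ... | c′ , _ , isCut with back g (gap φ) c′ (1≤gap φ) fits
        ...   | g′ , c , h , sh , _ = (λ x → toℕ x ℕ.< c) , lower-set-closed c ,
          Equivalence.from (preserve φ (fits-narrow h fits) (aligned-narrow h al)
            ((c , c′ , (λ _ → mk⇔ id id) , isCut , sh) ∷ cuts-narrow h alc)) p

  𝓘-ordinal : ∀ {N} → Fin N → 𝓘 0 (ordinal N)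
  𝓘-ordinal {N} x = finite x (N , mk↔ₛ′ id id (λ _ → refl) (λ _ → refl))

  infinite-exists : ∀ {N m} {P : Fin N → Set₁} →
    Σ (Subset (ordinal N)) (λ X → (𝓘-rank (ordinal N ↾ X) ≡ m) × (∀ i → X i → P i)) →
    m ≡ 0 × ∃[ x ] P x
  infinite-exists {m = zero} (X , (r , _) , all) with 𝓘-nonempty r
  ... | x , [ p ] = refl , x , all x (recompute (lem (X x)) p)
  infinite-exists {m = suc m} (X , (r , least) , _) = ⊥-elim (least z<s
    (𝓘-sub (𝓘-ordinal (value (𝓘-nonempty r))) (↾↪ X) (𝓘-nonempty r)))

  exists-infinite : ∀ {N} {P : Fin N → Set₁} → ∃[ x ] P x →
    Σ (Subset (ordinal N)) (λ X → (𝓘-rank (ordinal N ↾ X) ≡ 0) × (∀ i → X i → P i))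
  exists-infinite (x , p) = (_≡ x) ,
    (𝓘-sub (𝓘-ordinal x) (↾↪ (_≡ x)) (x , [ refl ]) , λ ()) , λ { _ refl → p }

  -- Nonempty sets of positions in a finite word have rank 0. There `∃∞ᶠ 0` therefore means `∃ᶠ`,
  -- and the quantifiers of positive rank are false.
  flatten : ∀ {n} → FO∞ A.Carrier n → FOSet A.Carrier n 0
  flatten (x FO∞.<ᶠ y)       = x FOSet.<ᶠ y
  flatten (FO∞.letterᶠ b x)  = FOSet.letterᶠ b x
  flatten (FO∞.¬ᶠ φ)         = FOSet.¬ᶠ flatten φ
  flatten (φ FO∞.∧ᶠ ψ)       = flatten φ FOSet.∧ᶠ flatten ψ
  flatten (φ FO∞.∨ᶠ ψ)       = flatten φ FOSet.∨ᶠ flatten ψ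
  flatten (FO∞.∃ᶠ φ)         = FOSet.∃ᶠ flatten φ
  flatten (FO∞.∃∞ᶠ zero φ)    = FOSet.∃ᶠ flatten φ
  flatten (FO∞.∃∞ᶠ (suc _) _) = FOSet.∃ᶠ (zero FOSet.<ᶠ zero)

  flatten-⇔ : ∀ {N n} (φ : FO∞ A.Carrier n) s →
              ⟦_⟧∞ (constant N) φ s ⇔ ⟦_⟧ˢ (constant N) LeftClosed (flatten φ) s []
  flatten-⇔ (x FO∞.<ᶠ y)      s = mk⇔ id id
  flatten-⇔ (FO∞.letterᶠ b x) s = mk⇔ id id
  flatten-⇔ (FO∞.¬ᶠ φ)        s = ¬-cong-⇔ (flatten-⇔ φ s)
  flatten-⇔ (φ FO∞.∧ᶠ ψ)      s = flatten-⇔ φ s ×-⇔ flatten-⇔ ψ s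
  flatten-⇔ (φ FO∞.∨ᶠ ψ)      s = flatten-⇔ φ s ⊎-⇔ flatten-⇔ ψ s
  flatten-⇔ (FO∞.∃ᶠ φ)        s = ∃-⇔ λ x → flatten-⇔ φ (x ∷ s)
  flatten-⇔ (FO∞.∃∞ᶠ zero φ)  s = mk⇔
    (λ inf → let x , p = proj₂ (infinite-exists inf) in x , Equivalence.to (flatten-⇔ φ (x ∷ s)) p)
    (λ (x , p) → exists-infinite (x , Equivalence.from (flatten-⇔ φ (x ∷ s)) p))
  flatten-⇔ (FO∞.∃∞ᶠ (suc m) φ) s = mk⇔
    (λ inf → case proj₁ (infinite-exists inf) of λ ())
    (λ (x , lift lt) → ⊥-elim (ℕ.<-irrefl refl lt))

  module _ (L : Language A) where

    FOcut⇒stutters : DefinableFOcut L →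
      ∃[ K ] ∀ N → K ℕ.≤ N → holds L (constant N) ⇔ holds L (constant (suc N))
    FOcut⇒stutters (φ , def) = gap φ , λ N K≤N →
      ⇔-trans (def (constant N))
        (⇔-trans (preserve φ {g = 0} K≤N [] []) (⇔-sym (def (constant (suc N)))))

    FO∞⇒stutters : DefinableFO∞ L →
      ∃[ K ] ∀ N → K ℕ.≤ N → holds L (constant N) ⇔ holds L (constant (suc N))
    FO∞⇒stutters (φ , def) = gap (flatten φ) , λ N K≤N →
      ⇔-trans (⇔-trans (def (constant N)) (flatten-⇔ φ []))
        (⇔-trans (preserve (flatten φ) {g = 0} K≤N [] [])
          (⇔-sym (⇔-trans (def (constant (suc N))) (flatten-⇔ φ []))))

    definable⇒stutters : ∀ 𝓛 → Definable 𝓛 L →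
      ∃[ K ] ∀ N → K ℕ.≤ N → holds L (constant N) ⇔ holds L (constant (suc N))
    definable⇒stutters FO[∞]        = FO∞⇒stutters
    definable⇒stutters FO[cut]      = FOcut⇒stutters
    definable⇒stutters FO[cut]∩WMSO = FOcut⇒stutters ∘ proj₁

-- Aperiodicity of the members of a basis

uniform : ∀ s {P : Fin s → ℕ → Set} → (∀ i → ∃[ K ] ∀ k → K ℕ.≤ k → P i k) →
          ∃[ K ] ∀ i k → K ℕ.≤ k → P i k
uniform zero    f = 0 , λ ()
uniform (suc s) f with f zero | uniform s (f ∘ suc)
... | K , p | L , q = K ℕ.⊔ L , λ
  { zero    k le → p k (ℕ.m⊔n≤o⇒m≤o K L le)
  ; (suc i) k le → q i k (ℕ.m⊔n≤o⇒n≤o K L le)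
  }

unary : Setoid 0ℓ 0ℓ
unary = ≡.setoid ⊤

module _ (M : ⊛Monoid 0ℓ 0ℓ) where
  open ⊛Monoid M
  open Powers M

  -- Over a single letter a word amounts to its domain, and x is the image of the letter.
  power-morphism : Carrier → Morphism (free unary) M
  power-morphism x = record
    { func = record { to = λ w → x ^ dom w ; cong = λ (f , _) → ^-congʳ x f }
    ; homo = λ w → π-∏ (dom w) (λ i → word (dom (letter w i)) (const x))
    }

  value-language : Carrier → Carrier → Language unary
  value-language x y = record
    { holds    = λ w → Lift _ (x ^ dom w ≈ y)
    ; respects = λ (f , _) (lift eq) → lift (≈-trans (^-congʳ x (≃-sym f)) eq)
    }

  value-recognized : ∀ x y → Recognizes M (value-language x y)
  value-recognized x y = power-morphism x , λ w → mk⇔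
    (λ h → w , h , ≈-refl)
    (λ (v , lift eq , eq′) → lift (≈-trans (≈-sym eq′) eq))

  -- For any x and y, the words whose image under the letter's value x is y form a recognized, hence
  -- definable language, which does not distinguish the lengths k and k + 1 for large k. Finiteness
  -- gives one bound for all pairs, and y is then taken to be a power of x.
  definable⇒aperiodic : ((P : Set) → Dec P) → ∀ 𝓛 → Finite setoid →
    ((L : Language unary) → Recognizes M L → Definable 𝓛 L) → ∃[ K ] Aperiodic K
  definable⇒aperiodic lem 𝓛 (s , inv) definable = K , λ x → begin
    x ^⁺ suc K                  ≈⟨ ^-ordinal x (suc K) ⟨
    x ^ ordinal (suc (suc K))   ≈⟨ constant-from-K x ⟩
    x ^ ordinal (suc K)         ≈⟨ ^-ordinal x K ⟩
    x ^⁺ K                      ∎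
    where
    open SetoidReasoning setoid
    module I = Inverse inv

    stutters : ∀ i j → ∃[ K ] ∀ k → K ℕ.≤ k →
               I.from i ^ ordinal k ≈ I.from j → I.from i ^ ordinal (suc k) ≈ I.from j
    stutters i j =
      let K , p = FiniteWords.definable⇒stutters lem {unary} tt L 𝓛
                    (definable L (value-recognized _ _))
      in K , λ k K≤k eq → lower (Equivalence.to (p k K≤k) (lift eq))
      where
      L : Language unary
      L = value-language (I.from i) (I.from j)

    bound : ∃[ K ] ∀ i k → K ℕ.≤ k → ∀ j →
            I.from i ^ ordinal k ≈ I.from j → I.from i ^ ordinal (suc k) ≈ I.from j
    bound = uniform s λ i → let K , p = uniform s (stutters i) in K , λ k le j → p j k le

    K : ℕ
    K = proj₁ bound

    constant-from-K : ∀ x → x ^ ordinal (suc (suc K)) ≈ x ^ ordinal (suc K)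
    constant-from-K x = begin
      x ^ ordinal (suc (suc K))               ≈⟨ ^-congˡ _ (I.strictlyInverseʳ x) ⟨
      I.from (I.to x) ^ ordinal (suc (suc K)) ≈⟨ proj₂ bound (I.to x) (suc K) (ℕ.n≤1+n K) _
        (≈-trans (^-congˡ _ (I.strictlyInverseʳ x)) (≈-sym (I.strictlyInverseʳ _))) ⟩
      I.from (I.to (x ^ ordinal (suc K)))     ≈⟨ I.strictlyInverseʳ _ ⟩
      x ^ ordinal (suc K)                     ∎

-- Defining nearness

-- The classes of R meeting D have no last one.
Unending : ∀ α → Rel ∣ α ∣ 0ℓ → Subset α → Set
Unending α R D = (∃[ z ] D z) × (∀ z → D z → ∃[ z′ ] D z′ × α [ z < z′ ] × ¬ R z′ z)

module Limits (lem : (P : Set) → Dec P) (α : CountableOrder) {R : Rel ∣ α ∣ 0ℓ}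
              (R-refl : Reflexive R) (R-sym : Symmetric R) (R-trans : Transitive R) where
  open CountableOrder α hiding (Carrier)

  -- The hypothesis says that classes are convex, so once a later element of another class is
  -- reached, the earlier class does not return. Each such move discards a representative until the
  -- list is exhausted.
  unending⇒infinite : (∀ {u v z} → v < z → ¬ u < z → R u v → R z v) → ∀ {D} → Unending α R D →
                      ∀ zs → ¬ (∀ u → D u → Any (R u) zs)
  unending⇒infinite convex {D} ((z₀ , Dz₀) , next) zs cover =
    from zs z₀ Dz₀ λ u Du _ → cover u Du
    where
    from : ∀ zs z → D z → ¬ (∀ u → D u → ¬ u < z → Any (R u) zs)
    from []       z Dz cover = case cover z Dz (irrefl refl) of λ ()
    from (c ∷ cs) z Dz cover with lem (∃[ v ] D v × ¬ v < z × R v c)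
    ... | no ∄v = from cs z Dz λ u Du z≤u → case cover u Du z≤u of λ
      { (here p)  → ⊥-elim (∄v (u , Du , z≤u , p))
      ; (there q) → q
      }
    ... | yes (v , Dv , z≤v , p) with next v Dv
    ...   | z′ , Dz′ , v<z′ , ¬R = from cs z′ Dz′ λ u Du z′≤u →
      case cover u Du (λ u<z → z′≤u (<-trans u<z (<-of {α} v<z′ z≤v))) of λ
        { (here q)  → ⊥-elim (¬R (convex v<z′ z′≤u (R-trans q (R-sym p))))
        ; (there q) → q
        }

  last-class : ∀ {D} → ¬ Unending α R D →
               (∀ z → ¬ D z) ⊎ (∃[ z ] D z × ∀ z′ → D z′ → z < z′ → R z′ z)
  last-class {D} ¬unending with lem (∃ D)
  ... | no ∅ = inj₁ λ z Dz → ∅ (z , Dz)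
  ... | yes nonempty with lem (∃[ z ] D z × ∀ z′ → D z′ → z < z′ → R z′ z)
  ...   | yes last = inj₂ last
  ...   | no ¬last = ⊥-elim (¬unending (nonempty , λ z Dz →
    decidable-stable (lem _) λ ¬next → ¬last (z , Dz , λ z′ Dz′ z<z′ →
      decidable-stable (lem _) λ ¬R → ¬next (z′ , Dz′ , z<z′ , ¬R))))

-- Finitely many classes meet Z if and only if no cut is a limit of classes,
-- from the left or from the right.
module Cuts (lem : (P : Set) → Dec P) (α : CountableOrder) {R : Rel ∣ α ∣ 0ℓ}
            (R-refl : Reflexive R) (R-sym : Symmetric R) (R-trans : Transitive R)
            (Z : Subset α) where
  open CountableOrder α hiding (Carrier)
  private
    module Left  = Limits lem α {R} R-refl R-sym R-trans
    module Right = Limits lem (op α) {R} R-refl R-sym R-trans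

  Limit : Subset α → Set
  Limit Y = Unending α R (λ z → Z z × Y z) ⊎ Unending (op α) R (λ z → Z z × ¬ Y z)

  cover⇒no-limit : (∀ {u v z} → v < z → ¬ u < z → R u v → R z v) →
                   (∀ {u v z} → z < v → ¬ z < u → R u v → R z v) →
                   (∃[ zs ] ∀ z → Z z → Any (R z) zs) → ∀ Y → ¬ Limit Y
  cover⇒no-limit convex _ (zs , f) Y (inj₁ l) =
    Left.unending⇒infinite convex l zs λ u (Zu , _) → f u Zu
  cover⇒no-limit _ convex (zs , f) Y (inj₂ r) =
    Right.unending⇒infinite convex r zs λ u (Zu , _) → f u Zu

  -- Let Y be the cut of all points up to which finitely many representatives suffice. As Y is no
  -- limit from the left, finitely many suffice for all of Y. If Z had points beyond Y, there would
  -- be a first class among them, and adding it would extend the cover past Y.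
  no-limit⇒cover : (∀ Y → LeftClosed α Y → ¬ Limit Y) → ∃[ zs ] ∀ z → Z z → Any (R z) zs
  no-limit⇒cover ¬limit = whole
    where
    Y : Subset α
    Y z = ∃[ zs ] ∀ v → Z v → ¬ z < v → Any (R v) zs

    closed : LeftClosed α Y
    closed x<y (zs , f) = zs , λ v Zv v≤x → f v Zv λ y<v → v≤x (<-trans x<y y<v)

    below : ∃[ zs ] ∀ v → Z v → Y v → Any (R v) zs
    below with Left.last-class (λ l → ¬limit Y closed (inj₁ l))
    ... | inj₁ ∅ = [] , λ v Zv Yv → ⊥-elim (∅ v (Zv , Yv))
    ... | inj₂ (z , (_ , (zs , f)) , last) = z ∷ zs , λ v Zv Yv → case z <? v of λ
      { (yes z<v) → here (last v (Zv , Yv) z<v)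
      ; (no z≮v)  → there (f v Zv z≮v)
      }

    whole : ∃[ zs ] ∀ v → Z v → Any (R v) zs
    whole with below | Right.last-class (λ r → ¬limit Y closed (inj₂ r))
    ... | zs , f | inj₁ ∅ = zs , λ v Zv →
      f v Zv (decidable-stable (lem _) λ ¬Yv → ∅ v (Zv , ¬Yv))
    ... | zs , f | inj₂ (z , (_ , ¬Yz) , first) = ⊥-elim (¬Yz (z ∷ zs , λ v Zv v≤z →
      case lem (Y v) of λ
        { (yes Yv) → there (f v Zv Yv)
        ; (no ¬Yv) → case compare v z of λ
          { (tri< v<z _ _)  → here (first v (Zv , ¬Yv) v<z)
          ; (tri≈ _ refl _) → here R-refl
          ; (tri> _ _ z<v)  → ⊥-elim (v≤z z<v)
          }
        }))

module Sentences {A : Set} where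
  open FOSet

  infixr 6 _⇒ᶠ_
  _⇒ᶠ_ : ∀ {n k} → FOSet A n k → FOSet A n k → FOSet A n k
  φ ⇒ᶠ ψ = ¬ᶠ (φ ∧ᶠ (¬ᶠ ψ))

  ∀ᶠ : ∀ {n k} → FOSet A (suc n) k → FOSet A n k
  ∀ᶠ φ = ¬ᶠ (∃ᶠ (¬ᶠ φ))

  equal : ∀ {n k} → Fin n → Fin n → FOSet A n k
  equal x y = (¬ᶠ (x <ᶠ y)) ∧ᶠ (¬ᶠ (y <ᶠ x))

  hull : ∀ {n k} → Fin n → Fin n → Fin n → FOSet A n k
  hull x y z = (¬ᶠ ((z <ᶠ x) ∧ᶠ (z <ᶠ y))) ∧ᶠ (¬ᶠ ((x <ᶠ z) ∧ᶠ (y <ᶠ z)))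

  near-fin : ∀ {n k} → ℕ → Fin n → Fin n → FOSet A n k
  near-fin zero    x y = equal x y
  near-fin (suc m) x y = ∃ˢ (∀ᶠ (hull (suc x) (suc y) zero ⇒ᶠ
    (∃ᶠ ((zero ∈ᶠ zero) ∧ᶠ near-fin m (suc zero) zero))))

  -- `D₁` and `D₂` describe the same set in contexts with one and two new variables, which avoids
  -- weakening formulas.
  unending : ∀ {n k} (D₁ : FOSet A (suc n) k) (D₂ L R : FOSet A (suc (suc n)) k) → FOSet A n k
  unending D₁ D₂ L R = (∃ᶠ D₁) ∧ᶠ ∀ᶠ (D₁ ⇒ᶠ (∃ᶠ (D₂ ∧ᶠ (L ∧ᶠ (¬ᶠ R)))))

  left right : ∀ {n k} → Fin n → Fin n → Fin n → FOSet A n (suc k)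
  left  x y z = hull x y z ∧ᶠ (z ∈ᶠ zero)
  right x y z = hull x y z ∧ᶠ (¬ᶠ (z ∈ᶠ zero))

  near-cut : ∀ {n k} → ℕ → Fin n → Fin n → FOSet A n k
  near-cut zero    x y = equal x y
  near-cut (suc m) x y = ¬ᶠ (∃ˢ (
    unending (left (suc x) (suc y) zero) (left (suc (suc x)) (suc (suc y)) zero)
             (suc zero <ᶠ zero) (near-cut m zero (suc zero)) ∨ᶠ
    unending (right (suc x) (suc y) zero) (right (suc (suc x)) (suc (suc y)) zero)
             (zero <ᶠ suc zero) (near-cut m zero (suc zero))))

lower-lem : ((P : Set₁) → Dec P) → (P : Set) → Dec P
lower-lem lem₁ P = map′ lower lift (lem₁ (Lift _ P))

module Semantics (lem₁ : (P : Set₁) → Dec P) {A : Setoid 0ℓ 0ℓ} (w : Word A) where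
  open Sentences {Setoid.Carrier A}
  open FOSet using (_<ᶠ_; _∧ᶠ_; ¬ᶠ_; ∃ᶠ_; _∈ᶠ_)
  private
    α = dom w
    module α = CountableOrder α

  private
    lem : (P : Set) → Dec P
    lem = lower-lem lem₁

  module _ (C : ∀ α → Pred (Subset α) 0ℓ) where
    private
      infix 4 _,_⊨_
      _,_⊨_ : ∀ {n k} → Vec ∣ α ∣ n → Vec (Subset α) k → FOSet (Setoid.Carrier A) n k → Set₁
      s , T ⊨ φ = ⟦_⟧ˢ w C φ s T

    module _ {n k} {s : Vec ∣ α ∣ n} {T : Vec (Subset α) k} where

      ⊨-⇒ : ∀ φ ψ → (s , T ⊨ φ ⇒ᶠ ψ) ⇔ (s , T ⊨ φ → s , T ⊨ ψ)
      ⊨-⇒ φ ψ = mk⇔ (λ f p → decidable-stable (lem₁ _) λ ¬q → f (p , ¬q))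
                    (λ f (p , ¬q) → ¬q (f p))

      ⊨-∀ : ∀ φ → (s , T ⊨ ∀ᶠ φ) ⇔ (∀ x → x ∷ s , T ⊨ φ)
      ⊨-∀ φ = mk⇔ (λ f x → decidable-stable (lem₁ _) λ ¬p → f (x , ¬p))
                  (λ f (x , ¬p) → ¬p (f x))

      ⊨-equal : ∀ x y → (s , T ⊨ equal x y) ⇔ (Vec.lookup s x ≡ Vec.lookup s y)
      ⊨-equal x y = mk⇔ to from
        where
        to : (s , T ⊨ equal x y) → Vec.lookup s x ≡ Vec.lookup s y
        to (x≮y , y≮x) with α.compare (Vec.lookup s x) (Vec.lookup s y)
        ... | tri< lt _ _ = ⊥-elim (x≮y (lift lt))
        ... | tri≈ _ eq _ = eq
        ... | tri> _ _ gt = ⊥-elim (y≮x (lift gt))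

        from : Vec.lookup s x ≡ Vec.lookup s y → s , T ⊨ equal x y
        from eq = (λ (lift lt) → α.irrefl eq lt) , (λ (lift gt) → α.irrefl (sym eq) gt)

      ⊨-hull : ∀ x y z → (s , T ⊨ hull x y z) ⇔
               Hull α (Vec.lookup s x) (Vec.lookup s y) (Vec.lookup s z)
      ⊨-hull x y z = ¬-cong-⇔ (Lift-⇔ ×-⇔ Lift-⇔) ×-⇔ ¬-cong-⇔ (Lift-⇔ ×-⇔ Lift-⇔)

    module _ {n k} {s : Vec ∣ α ∣ n} {T : Vec (Subset α) k} where

      ⊨-unending : ∀ D₁ D₂ L R {D : Subset α} {_≺_ _~_ : Rel ∣ α ∣ 0ℓ} →
        (∀ z → (z ∷ s , T ⊨ D₁) ⇔ D z) → (∀ z z′ → (z′ ∷ z ∷ s , T ⊨ D₂) ⇔ D z′) →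
        (∀ z z′ → (z′ ∷ z ∷ s , T ⊨ L) ⇔ z ≺ z′) → (∀ z z′ → (z′ ∷ z ∷ s , T ⊨ R) ⇔ z′ ~ z) →
        (s , T ⊨ unending D₁ D₂ L R) ⇔
        ((∃[ z ] D z) × (∀ z → D z → ∃[ z′ ] D z′ × z ≺ z′ × ¬ (z′ ~ z)))
      ⊨-unending D₁ D₂ L R d₁ d₂ l r =
        ∃-⇔ d₁ ×-⇔ ⇔-trans (⊨-∀ (D₁ ⇒ᶠ (∃ᶠ (D₂ ∧ᶠ (L ∧ᶠ (¬ᶠ R)))))) (∀-⇔ λ z →
          ⇔-trans (⊨-⇒ D₁ (∃ᶠ (D₂ ∧ᶠ (L ∧ᶠ (¬ᶠ R))))) (→-cong-⇔ (d₁ z) (∃-⇔ λ z′ →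
            d₂ z z′ ×-⇔ (l z z′ ×-⇔ ¬-cong-⇔ (r z z′)))))

      ⊨-all-pairs : ∀ {φ} {_~_ : Rel ∣ α ∣ 0ℓ} → (∀ x y → (y ∷ x ∷ s , T ⊨ φ) ⇔ x ~ y) →
                    (s , T ⊨ ∀ᶠ (∀ᶠ φ)) ⇔ (∀ x y → x ~ y)
      ⊨-all-pairs {φ} e = ⇔-trans (⊨-∀ (∀ᶠ φ)) (∀-⇔ λ x → ⇔-trans (⊨-∀ φ) (∀-⇔ λ y → e x y))

  near-hull : ∀ m {x y z} → Hull α x y z → Near α m x y → Near α m z x
  near-hull m h p = near-sym m (near-convex m h p)

  ⊨-near-cut : ∀ m {n k} {s : Vec ∣ α ∣ n} {T : Vec (Subset α) k} x y →
               ⟦_⟧ˢ w LeftClosed (near-cut m x y) s T ⇔ Near α m (Vec.lookup s x) (Vec.lookup s y)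
  ⊨-near-cut zero    {s = s} {T} x y = ⊨-equal LeftClosed {s = s} {T} x y
  ⊨-near-cut (suc m) {s = s} {T} x y = ⇔-trans
    (¬-cong-⇔ (∃-⇔ λ Y → mk⇔ id id ×-⇔ limit⇔ Y))
    (mk⇔ (λ ¬limit → no-limit⇒cover λ Y closed l → ¬limit (Y , closed , l))
         (λ cover (Y , closed , l) → cover⇒no-limit
            (λ v<z z≤u p → near-hull m
              ((λ (z<v , _) → α.asym v<z z<v) , λ (_ , u<z) → z≤u u<z) (near-sym m p))
            (λ z<v u≤z p → near-hull m
              ((λ (_ , z<u) → u≤z z<u) , λ (v<z , _) → α.asym v<z z<v) (near-sym m p))
            cover Y l))
    where
    open Cuts lem α {Near α m} (near-refl m) (near-sym m) (near-trans m)
      (Hull α (Vec.lookup s x) (Vec.lookup s y))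

    inside : ∀ {j} (s′ : Vec ∣ α ∣ j) Y x y z →
             ⟦_⟧ˢ w LeftClosed (hull x y z) s′ (Y ∷ T) ⇔ _
    inside s′ Y = ⊨-hull LeftClosed {s = s′} {Y ∷ T}

    limit⇔ : ∀ Y → _ ⇔ Limit Y
    limit⇔ Y =
      ⊨-unending LeftClosed {s = s} {Y ∷ T} (left (suc x) (suc y) zero)
        (left (suc (suc x)) (suc (suc y)) zero) (suc zero <ᶠ zero) (near-cut m zero (suc zero))
        (λ z → inside (z ∷ s) Y (suc x) (suc y) zero ×-⇔ Lift-⇔)
        (λ z z′ → inside (z′ ∷ z ∷ s) Y (suc (suc x)) (suc (suc y)) zero ×-⇔ Lift-⇔)
        (λ _ _ → Lift-⇔)
        (λ z z′ → ⊨-near-cut m {s = z′ ∷ z ∷ s} {Y ∷ T} zero (suc zero))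
      ⊎-⇔
      ⊨-unending LeftClosed {s = s} {Y ∷ T} (right (suc x) (suc y) zero)
        (right (suc (suc x)) (suc (suc y)) zero) (zero <ᶠ suc zero) (near-cut m zero (suc zero))
        (λ z → inside (z ∷ s) Y (suc x) (suc y) zero ×-⇔ ¬-cong-⇔ Lift-⇔)
        (λ z z′ → inside (z′ ∷ z ∷ s) Y (suc (suc x)) (suc (suc y)) zero ×-⇔ ¬-cong-⇔ Lift-⇔)
        (λ _ _ → Lift-⇔)
        (λ z z′ → ⊨-near-cut m {s = z′ ∷ z ∷ s} {Y ∷ T} zero (suc zero))

  finite-cover : ∀ {m} {Z : Subset α} →
    (∃[ X ] FiniteSubset α X × ∀ z → Z z → ∃[ v ] X v × Near α m z v) ⇔
    (∃[ zs ] ∀ z → Z z → Any (Near α m z) zs)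
  finite-cover {m} {Z} = mk⇔ to from
    where
    to : (∃[ X ] FiniteSubset α X × ∀ z → Z z → ∃[ v ] X v × Near α m z v) →
         ∃[ zs ] ∀ z → Z z → Any (Near α m z) zs
    to (X , (k , inv) , f) = tabulate (value ∘ I.from) , λ z Zz →
      let v , Xv , p = f z Zz in
      Any.tabulate⁺ (I.to (v , [ Xv ]))
        (subst (Near α m z) (cong value (sym (I.strictlyInverseʳ (v , [ Xv ])))) p)
      where module I = Inverse inv

    from : (∃[ zs ] ∀ z → Z z → Any (Near α m z) zs) →
           ∃[ X ] FiniteSubset α X × ∀ z → Z z → ∃[ v ] X v × Near α m z v
    from (zs , f) = (_∈ zs) ,
      enumerated⇒finite (Refinement._≟_ (IsStrictTotalOrder._≟_ α.isStrictTotalOrder))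
        (mapWith∈ zs λ {x} p → x , [ p ])
        (λ { (x , [ p ]) → Any.mapWith∈⁺ _
          (x , recompute (_∈?_ (IsStrictTotalOrder._≟_ α.isStrictTotalOrder) x zs) p , refl) }) ,
      λ z Zz → find (f z Zz)

  ⊨-near-fin : ∀ m {n k} {s : Vec ∣ α ∣ n} {T : Vec (Subset α) k} x y →
               ⟦_⟧ˢ w FiniteSubset (near-fin m x y) s T ⇔ Near α m (Vec.lookup s x) (Vec.lookup s y)
  ⊨-near-fin zero    {s = s} {T} x y = ⊨-equal FiniteSubset {s = s} {T} x y
  ⊨-near-fin (suc m) {s = s} {T} x y = ⇔-trans
    (∃-⇔ λ X → mk⇔ id id ×-⇔ ⇔-trans
      (⊨-∀ FiniteSubset {s = s} {X ∷ T} (hull (suc x) (suc y) zero ⇒ᶠ covered))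
      (∀-⇔ λ z → ⇔-trans
        (⊨-⇒ FiniteSubset {s = z ∷ s} {X ∷ T} (hull (suc x) (suc y) zero) covered)
        (→-cong-⇔ (⊨-hull FiniteSubset {s = z ∷ s} {X ∷ T} (suc x) (suc y) zero)
          (∃-⇔ λ v → Lift-⇔ ×-⇔ ⊨-near-fin m {s = v ∷ z ∷ s} {X ∷ T} (suc zero) zero))))
    finite-cover
    where
    covered : ∀ {n k} → FOSet (Setoid.Carrier A) (suc n) (suc k)
    covered = ∃ᶠ ((zero ∈ᶠ zero) ∧ᶠ near-fin m (suc zero) zero)

-- Separating nested words

module EmptyWord {A : Setoid 0ℓ 0ℓ} where

  ε : Word A
  ε = word (ordinal 0) λ ()

  -- Without positions no atom has variables to refer to, and point quantifiers are false, the
  -- infinitary ones because orders with a rank are nonempty.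
  decide-FO∞ : ∀ {n} (φ : FO∞ (Setoid.Carrier A) n) s → Dec (⟦_⟧∞ ε φ s)
  decide-FO∞ (x FO∞.<ᶠ _)      s = case Vec.lookup s x of λ ()
  decide-FO∞ (FO∞.letterᶠ _ x) s = case Vec.lookup s x of λ ()
  decide-FO∞ (FO∞.¬ᶠ φ)        s = ¬? (decide-FO∞ φ s)
  decide-FO∞ (φ FO∞.∧ᶠ ψ)      s = decide-FO∞ φ s ×-dec decide-FO∞ ψ s
  decide-FO∞ (φ FO∞.∨ᶠ ψ)      s = decide-FO∞ φ s ⊎-dec decide-FO∞ ψ s
  decide-FO∞ (FO∞.∃ᶠ φ)        s = no λ ()
  decide-FO∞ (FO∞.∃∞ᶠ m φ)     s = no λ { (X , (r , _) , _) → case value (𝓘-nonempty r) of λ () }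

  -- Set variables do not matter, since there are no positions.
  decide-FOcut : ∀ {n k} (φ : FOSet (Setoid.Carrier A) n k) s →
                 (∀ S → ⟦_⟧ˢ ε LeftClosed φ s S) ⊎ (∀ S → ¬ ⟦_⟧ˢ ε LeftClosed φ s S)
  decide-FOcut (x FOSet.<ᶠ _)      s = case Vec.lookup s x of λ ()
  decide-FOcut (FOSet.letterᶠ _ x) s = case Vec.lookup s x of λ ()
  decide-FOcut (x FOSet.∈ᶠ _)      s = case Vec.lookup s x of λ ()
  decide-FOcut (FOSet.¬ᶠ φ) s with decide-FOcut φ s
  ... | inj₁ p  = inj₂ λ S ¬p → ¬p (p S)
  ... | inj₂ ¬p = inj₁ ¬p
  decide-FOcut (φ FOSet.∧ᶠ ψ) s with decide-FOcut φ s | decide-FOcut ψ s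
  ... | inj₁ p  | inj₁ q  = inj₁ λ S → p S , q S
  ... | inj₂ ¬p | _       = inj₂ λ S (p , _) → ¬p S p
  ... | _       | inj₂ ¬q = inj₂ λ S (_ , q) → ¬q S q
  decide-FOcut (φ FOSet.∨ᶠ ψ) s with decide-FOcut φ s | decide-FOcut ψ s
  ... | inj₁ p  | _       = inj₁ λ S → inj₁ (p S)
  ... | _       | inj₁ q  = inj₁ λ S → inj₂ (q S)
  ... | inj₂ ¬p | inj₂ ¬q = inj₂ λ { S (inj₁ p) → ¬p S p ; S (inj₂ q) → ¬q S q }
  decide-FOcut (FOSet.∃ᶠ φ) s = inj₂ λ { _ () }
  decide-FOcut (FOSet.∃ˢ φ) s with decide-FOcut φ s
  ... | inj₁ p  = inj₁ λ S → (λ _ → ⊥) , (λ _ ()) , p _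
  ... | inj₂ ¬p = inj₂ λ S (X , _ , p) → ¬p (X ∷ S) p

  decide : ∀ 𝓛 (L : Language A) → Definable 𝓛 L → Dec (holds L ε)
  decide FO[∞]        L (φ , def) = Decidable.map (⇔-sym (def ε)) (decide-FO∞ φ [])
  decide FO[cut]      L (φ , def) with decide-FOcut φ []
  ... | inj₁ p  = yes (Equivalence.from (def ε) (p []))
  ... | inj₂ ¬p = no λ h → ¬p [] (Equivalence.to (def ε) h)
  decide FO[cut]∩WMSO L (d , _) = decide FO[cut] L d

module _ {c ℓ c′ ℓ′} {M : ⊛Monoid c ℓ} {N : ⊛Monoid c′ ℓ′} (h : Morphism M N) where
  private
    module M where
      open ⊛Monoid M public
      open Powers M public
    module N where
      open ⊛Monoid N public
      open ⊛MonoidProperties N public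
      open Powers N public
  open Morphism h

  homo-· : ∀ x y → to (x M.· y) N.≈ to x N.· to y
  homo-· x y = N.≈-trans (homo _)
    (N.π-cong (≅-letters λ { zero → N.≈-refl ; (suc zero) → N.≈-refl }))

  homo-^ : ∀ x α → to (x M.^ α) N.≈ to x N.^ α
  homo-^ x α = homo _

  homo-^⁺ : ∀ x n → to (x M.^⁺ n) N.≈ to x N.^⁺ n
  homo-^⁺ x zero    = N.≈-refl
  homo-^⁺ x (suc n) = N.≈-trans (homo-· _ _) (N.·-cong N.≈-refl (homo-^⁺ x n))

  homo-iter : ∀ K n x → to (M.iter K n x) N.≈ N.iter K n (to x)
  homo-iter K zero    x = N.≈-refl
  homo-iter K (suc n) x = N.≈-trans (homo-^⁺ _ K)
    (N.^⁺-cong K (N.≈-trans (homo-^ _ Ω) (N.^-congˡ Ω (homo-iter K n x))))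

module F where
  open ⊛Monoid (free unary) public
  open Powers (free unary) public

-- The word F^n(a). The exponent K stays a parameter because it depends on the recognizing monoid.
nested : ℕ → ℕ → Word unary
nested K n = F.iter K n ⟪ tt ∷ [] ⟫

^⁺-↪ : ∀ w K → dom w ↪ dom (w F.^⁺ K)
^⁺-↪ w zero    = record { to = id ; mono = id }
^⁺-↪ w (suc K) = record { to = zero ,_ ; mono = snd }

module Rank (lem₁ : (P : Set₁) → Dec P) where

  private
    lem : (P : Set) → Dec P
    lem = lower-lem lem₁

  open Nearness lem
  open Suborders lem

  𝓘-^⁺ : ∀ {n} w K → 𝓘 (suc n) (dom w) → 𝓘 (suc n) (dom (w F.^⁺ K))
  𝓘-^⁺ w zero    r = r
  𝓘-^⁺ w (suc K) r = 𝓘-⊕ (dom ∘ lookup (w ∷ w F.^⁺ K ∷ []))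
    (λ { zero → r ; (suc zero) → 𝓘-^⁺ w K r }) ≃-refl

  𝓘-nested : ∀ K n → 𝓘 n (dom (nested K n))
  𝓘-nested K zero    = finite zero (1 , mk↔ₛ′ id id (λ _ → refl) (λ _ → refl))
  𝓘-nested K (suc n) = 𝓘-^⁺ (nested K n F.^ Ω) K (𝓘-Ω (𝓘-nested K n))

  -- The first factor of the outer power is already an `Ω`-sum of copies of the previous word, and
  -- infinitely many of these copies are pairwise far apart.
  ¬small-nested : ∀ K n → ¬ Small (dom (nested K (suc n))) n
  ¬small-nested K zero    s =
    ∑Ω-¬small₀ {ordinal 1} zero (small-reflect (^⁺-↪ (nested K 0 F.^ Ω) K) 0 s)
  ¬small-nested K (suc n) s =
    ∑Ω-¬small (𝓘-nonempty (𝓘-nested K (suc n))) (¬small-nested K n)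
      (small-reflect (^⁺-↪ (nested K (suc n) F.^ Ω) K) (suc n) s)

  AllNear : ℕ → CountableOrder → Set
  AllNear n α = ∀ x y → Near α n x y

  small⇒all-near : ∀ {n α} → Small α n → AllNear (suc n) α
  small⇒all-near (zs , f) x y = zs , λ z _ → f z

  ¬all-near-nested : ∀ K n → ¬ AllNear (suc n) (dom (nested K (suc (suc n))))
  -- The points lie in copies 0 and 2, so that the whole of copy 1, which is not small, lies between
  -- them.
  ¬all-near-nested K n all = copies-apart a n (¬small-nested K n) {0} {1} z<s
    (near-reflect e (suc n) (all (_↪_.to e (lo 0 , a)) (_↪_.to e (lo 2 , a))))
    where
    a : ∣ dom (nested K (suc n)) ∣
    a = 𝓘-nonempty (𝓘-nested K (suc n))

    e : dom (nested K (suc n) F.^ Ω) ↪ dom (nested K (suc (suc n)))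
    e = ^⁺-↪ (nested K (suc n) F.^ Ω) K

  near-language : ℕ → Language unary
  near-language n = record
    { holds    = λ w → Lift _ (AllNear n (dom w))
    ; respects = λ { (f , _) (lift all) → lift λ x y → near-reflect (≃⇒↪ (≃-sym f)) n (all _ _) }
    }

  near-FOcut : ∀ n → DefinableFOcut (near-language n)
  near-FOcut n = ∀ᶠ (∀ᶠ φ) , λ w → let open Semantics lem₁ w in ⇔-trans Lift-⇔
    (⇔-sym (⊨-all-pairs LeftClosed {s = []} {[]} {φ} λ x y →
      ⊨-near-cut n {s = y ∷ x ∷ []} {[]} (suc zero) zero))
    where
    open Sentences
    φ : FOSet ⊤ 2 0
    φ = near-cut n (suc zero) zero

  near-WMSO : ∀ n → DefinableWMSO (near-language n)
  near-WMSO n = ∀ᶠ (∀ᶠ φ) , λ w → let open Semantics lem₁ w in ⇔-trans Lift-⇔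
    (⇔-sym (⊨-all-pairs FiniteSubset {s = []} {[]} {φ} λ x y →
      ⊨-near-fin n {s = y ∷ x ∷ []} {[]} (suc zero) zero))
    where
    open Sentences
    φ : FOSet ⊤ 2 0
    φ = near-fin n (suc zero) zero

  -- The inner formula is always true, so the sentence asserts that some set of positions has rank
  -- n.
  rank-sentence : ℕ → FO∞ ⊤ 0
  rank-sentence n = FO∞.∃∞ᶠ n (FO∞.¬ᶠ (zero FO∞.<ᶠ zero))

  rank-language : ℕ → Language unary
  rank-language n = record
    { holds    = λ w → ⟦_⟧∞ w (rank-sentence n) []
    ; respects = λ { {u} {v} (f , _) (X , (r , least) , _) → transport f X r least }
    }
    where
    transport : ∀ {u v : Word unary} (f : dom u ≃ dom v) X → 𝓘 n (dom u ↾ X) →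
                (∀ {m} → m ℕ.< n → ¬ 𝓘 m (dom u ↾ X)) → ⟦_⟧∞ v (rank-sentence n) []
    transport {u} {v} f X r least = Y ,
      (𝓘-sub r g₁ (_↪_.to g₂ (𝓘-nonempty r)) ,
       λ m<n r′ → least m<n (𝓘-sub r′ g₂ (𝓘-nonempty r))) ,
      λ i _ (lift lt) → CountableOrder.irrefl (dom v) refl lt
      where
      module f = _≃_ f
      module g = _≃_ (≃-sym f)

      Y : Subset (dom v)
      Y y = X (g.to y)

      g₁ : dom v ↾ Y ↪ dom u ↾ X
      g₁ = record { to = λ { (y , p) → g.to y , p } ; mono = g.mono }

      g₂ : dom u ↾ X ↪ dom v ↾ Y
      g₂ = record
        { to   = λ { (x , [ p ]) → f.to x ,
                     [ subst X (sym (f.injective (proj₂ (f.strictlySurjective (f.to x))))) p ] }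
        ; mono = f.mono
        }

  -- The set of all positions is the witness; a rank of at most n would make the word small of order
  -- n.
  rank-nested : ∀ K n → holds (rank-language (suc n)) (nested K (suc n))
  rank-nested K n = (λ _ → ⊤) ,
    (𝓘-sub r (↾↪ _) (𝓘-nonempty r , [ tt ]) ,
     λ { (s≤s m≤n) r′ → ¬small-nested K n (small-≤ (ℕ.≤⇒≤′ m≤n)
       (small-reflect (record { to = λ x → x , [ tt ] ; mono = id }) _ (𝓘⇒small r′))) }) ,
    λ i _ (lift lt) → CountableOrder.irrefl (dom (nested K (suc n))) refl lt
    where
    r : 𝓘 (suc n) (dom (nested K (suc n)))
    r = 𝓘-nested K (suc n)

  -- Suborders do not increase the rank.
  ¬rank-nested : ∀ K n → ¬ holds (rank-language (suc n)) (nested K n)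
  ¬rank-nested K n (X , (r , least) , _) =
    least (ℕ.n<1+n n) (𝓘-sub (𝓘-nested K n) (↾↪ X) (𝓘-nonempty r))

  -- The language is fixed before K, because the exponent is known only once a monoid recognizing
  -- the language is given.
  separating-language : ∀ 𝓛 n → Σ (Language unary) λ L → Definable 𝓛 L × ∀ K →
    ∃[ i ] ∃[ j ] holds L (nested K (i ℕ.+ n)) × ¬ holds L (nested K (j ℕ.+ n))
  separating-language FO[∞] n =
    rank-language (suc n) , (rank-sentence (suc n) , λ _ → mk⇔ id id) , λ K →
    1 , 0 , rank-nested K n , ¬rank-nested K n
  separating-language FO[cut] n =
    near-language (suc n) , near-FOcut (suc n) , λ K →
    0 , 2 , lift (small⇒all-near (𝓘⇒small (𝓘-nested K n))) , ¬all-near-nested K n ∘ lower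
  separating-language FO[cut]∩WMSO n =
    near-language (suc n) , (near-FOcut (suc n) , near-WMSO (suc n)) , λ K →
    0 , 2 , lift (small⇒all-near (𝓘⇒small (𝓘-nested K n))) , ¬all-near-nested K n ∘ lower

-- A uniform bound for iterated block products

StableAt : ℕ → ⊛Monoid 0ℓ 0ℓ → Set
StableAt n M = ∃[ K ] Powers.Stable M n K

stable-at-≤ : ∀ M {m n} → m ℕ.≤′ n → StableAt m M → StableAt n M
stable-at-≤ M (ℕ.≤′-reflexive refl) s = s
stable-at-≤ M (ℕ.≤′-step m≤n)       s =
  let K , S = stable-at-≤ M m≤n s in K , Powers.stable-suc M S

-- A maximum over the finite basis, with a successor because block products preserve stability only
-- for a positive number of steps.
common-bound : ∀ {B} → All (λ M → ∃[ n ] StableAt n M) B → ∃[ n ] All (StableAt (suc n)) B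
common-bound [] = 0 , []
common-bound {M ∷ B} ((m , s) ∷ ss) = let n , S = common-bound ss in m ℕ.⊔ n ,
  stable-at-≤ M (ℕ.≤⇒≤′ (ℕ.m≤n⇒m≤1+n (ℕ.m≤m⊔n m n))) s ∷
  All.map (λ {N} → stable-at-≤ N (ℕ.≤⇒≤′ (s≤s (ℕ.m≤n⊔m m n)))) S

-- The exponent is chosen anew at each block product, from the maximum of those of the factors,
-- while n stays fixed.
iterated-stable : ∀ {B n} → All (StableAt (suc n)) B → ∀ {M} → Iterated□ B M → StableAt (suc n) M
iterated-stable S (member M∈B) = All.lookup S M∈B
iterated-stable S (block {M} {N} IM IN) =
  let K , SM = iterated-stable S IM
      L , SN = iterated-stable S IN
      open BlockStability M N
  in _ , □-stable (Powers.stable-≤ M SM (ℕ.≤⇒≤′ (ℕ.m≤m⊔n K L)))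
                  (Powers.stable-≤ N SN (ℕ.≤⇒≤′ (ℕ.m≤n⊔m K L)))

-- From index n on, all nested words have the same image, and membership in L depends only on the
-- image.
recognizes-nested : ∀ {n} M → StableAt n M → (L : Language unary) → Recognizes M L →
  ∃[ K ] ∀ i j → holds L (nested K (i ℕ.+ n)) → holds L (nested K (j ℕ.+ n))
recognizes-nested {n} M (K , S) L (h , rec) = K , λ i j p →
  Equivalence.from (rec (nested K (j ℕ.+ n)))
    (nested K (i ℕ.+ n) , p , ≈-trans (value≈ i) (≈-sym (value≈ j)))
  where
  open ⊛Monoid M
  open Powers M
  open Morphism h
  value≈ : ∀ i → to (nested K (i ℕ.+ n)) ≈ iter K n (to ⟪ tt ∷ [] ⟫)
  value≈ i = ≈-trans (homo-iter h K (i ℕ.+ n) _) (stable-+ S i _)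

theorem7 : (𝓛 : Logic) →
    ¬ (Σ (List (⊛Monoid 0ℓ 0ℓ)) λ B →
    All (λ M → Finite (⊛Monoid.setoid M)) B ×
    ((A : Setoid 0ℓ 0ℓ) → Finite A → (L : Language A) →
    Definable 𝓛 L ⇔ (Σ (⊛Monoid 0ℓ 0ℓ) λ M → Iterated□ B M × Recognizes M L)))
theorem7 𝓛 (B , finite-members , basis) =
  let n , S             = common-bound members-stable
      L , definable , w = Rank.separating-language lem₁ 𝓛 (suc n)
      M , IM , rec      = recognized L definable
      K , same          = recognizes-nested M (iterated-stable S IM) L rec
      i , j , p , ¬p    = w K
  in ¬p (same i j p)
  where
  unary-finite : Finite unary
  unary-finite = 1 , mk↔ₛ′ (λ _ → zero) (λ _ → tt) (λ { zero → refl }) (λ _ → refl)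

  recognized : (L : Language unary) → Definable 𝓛 L →
               Σ (⊛Monoid 0ℓ 0ℓ) λ M → Iterated□ B M × Recognizes M L
  recognized L = Equivalence.to (basis unary unary-finite L)

  definable-by : (L : Language unary) → ∀ {M} → Iterated□ B M → Recognizes M L → Definable 𝓛 L
  definable-by L IM rec = Equivalence.from (basis unary unary-finite L) (_ , IM , rec)

  constantly : Set₁ → Language unary
  constantly P = record { holds = λ _ → P ; respects = λ _ p → p }

  constantly-⊤-definable : ∀ 𝓛 → Definable 𝓛 (constantly (Lift _ ⊤))
  constantly-⊤-definable FO[∞] = FO∞.¬ᶠ (FO∞.∃ᶠ (zero FO∞.<ᶠ zero)) , λ w →
    mk⇔ (λ _ (_ , lift lt) → CountableOrder.irrefl (dom w) refl lt) (λ _ → lift tt)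
  constantly-⊤-definable FO[cut] = FOSet.¬ᶠ (FOSet.∃ᶠ (zero FOSet.<ᶠ zero)) , λ w →
    mk⇔ (λ _ (_ , lift lt) → CountableOrder.irrefl (dom w) refl lt) (λ _ → lift tt)
  constantly-⊤-definable FO[cut]∩WMSO = constantly-⊤-definable FO[cut] ,
    FOSet.¬ᶠ (FOSet.∃ᶠ (zero FOSet.<ᶠ zero)) , λ w →
    mk⇔ (λ _ (_ , lift lt) → CountableOrder.irrefl (dom w) refl lt) (λ _ → lift tt)

  lem₁ : (P : Set₁) → Dec P
  -- The morphism obtained for the language of all words also recognizes `constantly P`, whether P
  -- holds or not, and deciding the empty word decides P.
  lem₁ P = let M , IM , h , _ = recognized _ (constantly-⊤-definable 𝓛) in
    EmptyWord.decide 𝓛 (constantly P) (definable-by (constantly P) IM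
      (h , λ w → mk⇔ (λ p → w , p , ⊛Monoid.≈-refl M) (λ (_ , p , _) → p)))

  members-stable : All (λ M → ∃[ n ] StableAt n M) B
  members-stable = All.tabulate λ {M} M∈B →
    -- A member is itself an iterated block product, so the languages it recognizes are definable;
    -- this makes it aperiodic, and its size bounds the number of steps.
    let s , inv = All.lookup finite-members M∈B
        K , ap  = definable⇒aperiodic M (lower-lem lem₁) 𝓛 (s , inv) λ L →
                    definable-by L (member M∈B)
    in s , K , Powers.finite⇒stable M inv ap
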